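{- Let $T$ be a tree with vertex set $\{1,\ldots,n\}$, edge set $\{e_1,\ldots,e_{n-1}\}$ and nonzero real edge weights $w_1,\ldots,w_{n-1}$. Let $q$ be a vertex of degree $2$ with neighbours $p$ and $r$, and let $e_i=\{p,q\}$, $e_j=\{q,r\}$. Then the squared distance matrix $\Delta$ of $T$ satisfies $$\det\Delta=(-1)^{n-1}2^{2n-5}(w_i+w_j)^2\prod_{s=1}^{n-1}w_s^2\prod_{k\neq q}\tau_k.$$
   Context: For vertices $a\neq b$, $d(a,b)$ is the sum of the weights of the edges on the unique $ab$-path, $d(a,a)=0$, and $\Delta$ is the $n\times n$ matrix with $(a,b)$-entry $d(a,b)^2$. $\tau_k=2-\delta_k$ where $\delta_k$ is the degree of vertex $k$; the product $\prod_{k\neq q}$ runs over all vertices $k\in\{1,\ldots,n\}$ other than $q$. -}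

module Defs where

open import Level using (Level)
open import Data.Nat using (ℕ; zero; suc)
open import Data.Fin using (Fin; zero; suc; punchIn)
open import Data.Fin.Properties using (_≟_)
open import Data.Product using (_×_; _,_; proj₁; proj₂)
open import Data.Sum using (_⊎_)
open import Data.List using (List; []; _∷_)
open import Data.List.Relation.Unary.Unique.Propositional using (Unique)
open import Relation.Nullary using (yes; no)
open import Relation.Binary.PropositionalEquality using (_≡_; _≢_)
open import Algebra.Bundles using (CommutativeRing)

-- Graphs with vertex set Fin n and edges e₁,…,e_m, given by their two
-- endpoints (edge i is the unordered pair {proj₁ (e i), proj₂ (e i)}).

Edges : ℕ → ℕ → Set
Edges n m = Fin m → Fin n × Fin n

module _ {n m : ℕ} (e : Edges n m) where

  EdgeIs : Fin m → Fin n → Fin n → Set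
  EdgeIs i a c = (e i ≡ (a , c)) ⊎ (e i ≡ (c , a))

  data Walk : Fin n → Fin n → Set where
    done : ∀ {a} → Walk a a
    step : ∀ {a c b} (i : Fin m) → EdgeIs i a c → Walk c b → Walk a b

  edgesOf : ∀ {a b} → Walk a b → List (Fin m)
  edgesOf done = []
  edgesOf (step i _ W) = i ∷ edgesOf W

  verticesOf : ∀ {a b} → Walk a b → List (Fin n)
  verticesOf {a} done = a ∷ []
  verticesOf {a} (step i _ W) = a ∷ verticesOf W

  record Path (a b : Fin n) : Set where
    constructor path
    field
      walk     : Walk a b
      distinct : Unique (verticesOf walk)

  record IsTree : Set where
    field
      loopless   : ∀ i → proj₁ (e i) ≢ proj₂ (e i)
      thePath    : ∀ a b → Path a b
      pathUnique : ∀ a b (P P′ : Path a b) →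
                   edgesOf (Path.walk P) ≡ edgesOf (Path.walk P′)

  degree : Fin n → ℕ
  degree k = go m e
    where
      inc : Fin n × Fin n → ℕ
      inc (a , c) with a ≟ k | c ≟ k
      ... | yes _ | _     = 1
      ... | no _  | yes _ = 1
      ... | no _  | no _  = 0
      go : ∀ m′ → (Fin m′ → Fin n × Fin n) → ℕ
      go zero    f = 0
      go (suc m′) f = inc (f zero) Data.Nat.+ go m′ (λ x → f (suc x))

-- Ring-valued notions (the real numbers are replaced by an arbitrary
-- commutative ring R).

module _ {c ℓ : Level} (R : CommutativeRing c ℓ) where
  open CommutativeRing R hiding (zero)

  fromℕ : ℕ → Carrier
  fromℕ zero    = 0#
  fromℕ (suc k) = 1# + fromℕ k

  pow : Carrier → ℕ → Carrier
  pow x zero    = 1#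
  pow x (suc k) = x * pow x k

  sumFin : ∀ k → (Fin k → Carrier) → Carrier
  sumFin zero    f = 0#
  sumFin (suc k) f = f zero + sumFin k (λ x → f (suc x))

  prodFin : ∀ k → (Fin k → Carrier) → Carrier
  prodFin zero    f = 1#
  prodFin (suc k) f = f zero * prodFin k (λ x → f (suc x))

  sumList : ∀ {m} → (Fin m → Carrier) → List (Fin m) → Carrier
  sumList w []       = 0#
  sumList w (i ∷ is) = w i + sumList w is

  det : ∀ k → (Fin k → Fin k → Carrier) → Carrier
  det zero    M = 1#
  det (suc k) M = sumFin (suc k) λ j →
    pow (- 1#) (Data.Fin.toℕ j) * M zero j
      * det k (λ a b → M (suc a) (punchIn j b))

  dist : ∀ {n m} (e : Edges n m) → IsTree e → (Fin m → Carrier) →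
         Fin n → Fin n → Carrier
  dist e T w a b = sumList w (edgesOf e (Path.walk (IsTree.thePath T a b)))

  Δ : ∀ {n m} (e : Edges n m) → IsTree e → (Fin m → Carrier) →
      Fin n → Fin n → Carrier
  Δ e T w a b = dist e T w a b * dist e T w a b

  τ : ∀ {n m} (e : Edges n m) → Fin n → Carrier
  τ e k = fromℕ 2 - fromℕ (degree e k)

  prodExcept : ∀ n → Fin n → (Fin n → Carrier) → Carrier
  prodExcept n q f = prodFin n λ k → ite (k ≟ q) where
    ite : ∀ {k} → Relation.Nullary.Dec (k ≡ q) → Carrier
    ite {k} (yes _) = 1#
    ite {k} (no _)  = f k

{-# OPTIONS --safe #-}
module Submission where

-- Root the tree at q, so that p and r are the children of q. For a ≢ q and b ≢ q, subtracting from each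
-- row and column of Δ that of the parent turns the (a, b)-entry into -2 W a W b H a b, where H a b = 1 if one
-- of a, b is an ancestor of the other (or a = b) and H a b = -1 otherwise. Rows p and r of H are opposite, so
-- adding row p to row r leaves (w i + w j) times a unit vector, and likewise for columns; expanding along them
-- leaves the rows and columns of the vertices other than q and r. There, subtracting from row a the rows of
-- its children leaves -2 (1 - #children a) (2 Z b a - 1), with Z b a = 1 if b is an ancestor of a or b = a, and 0
-- otherwise. After taking out the row factors, subtracting parent rows again makes the matrix diagonal up to
-- row and column p, and the entry left at p is τ r. No step divides, so the ring can be arbitrary.

open import Defs
open import Level using (Level; _⊔_)
open import Algebra.Bundles using (CommutativeMonoid; CommutativeRing)
open import Algebra.Solver.Ring.AlmostCommutativeRing using (fromCommutativeRing; _-Raw-AlmostCommutative⟶_)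
import Algebra.Solver.Ring
import Algebra.Properties.Ring
import Algebra.Properties.AbelianGroup
import Algebra.Properties.CommutativeMonoid.Sum
open import Data.Bool using (if_then_else_)
open import Data.Fin using (Fin; zero; suc; toℕ; punchIn; punchOut)
open import Data.Fin.Permutation using (Permutation′; permutation; _⟨$⟩ʳ_)
open import Data.Fin.Properties using (_≟_; punchIn-punchOut; punchOut-punchIn; punchOut-cong; punchInᵢ≢i)
import Data.Fin.Properties as Fin
import Data.Integer as ℤ
import Data.Integer.Properties as ℤ
open import Data.List using (List; []; _∷_; _++_; _∷ʳ_; allFin; length; reverse)
import Data.List.Membership.DecPropositional
open import Data.List.Membership.Propositional using (_∈_; _∉_)
open import Data.List.Membership.Propositional.Properties using (∈-allFin)
import Data.List.Properties as List
open import Data.List.Relation.Binary.Permutation.Propositional using (↭-sym; ↭⇒↭ₛ)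
open import Data.List.Relation.Binary.Permutation.Propositional.Properties using (↭-reverse)
import Data.List.Relation.Binary.Permutation.Setoid.Properties as Permutation
open import Data.List.Relation.Unary.All using (All; []; _∷_)
open import Data.List.Relation.Unary.All.Properties using (¬Any⇒All¬)
open import Data.List.Relation.Unary.AllPairs using ([]; _∷_)
open import Data.List.Relation.Unary.Any using (here; there)
open import Data.List.Relation.Unary.Unique.Propositional using (Unique)
open import Data.Maybe using (Maybe; just; nothing)
open import Data.Nat using (ℕ; zero; suc; _∸_; _<_; _≤_; z≤n; s≤s)
import Data.Nat as ℕ
open import Data.Nat.Induction using (<-wellFounded)
import Data.Nat.Properties as ℕ
import Data.Nat.Tactic.RingSolver as ℕ-Solver
open import Data.Product using (_×_; _,_; proj₁; proj₂; ∃; Σ-syntax)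
open import Data.Sum using (_⊎_; inj₁; inj₂; [_,_])
import Data.Sum as ⊎
open import Data.Unit.Polymorphic using (⊤; tt)
open import Function using (_∘_)
open import Induction.WellFounded using (Acc; acc)
open import Relation.Binary.PropositionalEquality using (_≡_; _≢_; _≗_)
import Relation.Binary.PropositionalEquality as ≡
import Relation.Binary.Reasoning.Setoid
open import Relation.Nullary using (Dec; yes; no; ¬_; does; contradiction)
open import Relation.Nullary.Decidable using (dec-true; dec-false)

-- Subtracting parents from rows and columns takes a mixed second difference of a square, which is
-- twice the product of the two signed increments of the distance; that is why only signs `H a b`
-- and weights survive. Every vertex but the root equals or descends from exactly one of `p` and
-- `r`, hence the opposite rows, and the factor `W p + W r` is what the border along `q` retains
-- when they are added. Children are counted because a strict descendant of `a` lies below exactly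
-- one child of `a`; away from the root the degree exceeds the number of children by one, so one
-- minus that number is `τ`. The constant: the core rows give `n - 2` factors -2, the final diagonal
-- gives `n - 3` factors 2, and one exchange of rows gives a sign, so the total is -(-2)^(n-2)
-- 2^(n-3). Matrices never shrink. Split-off rows and columns are replaced by those of an identity
-- matrix, so indices remain vertices of the tree and no cofactor signs have to be tracked.

module IntegerSolver {c ℓ : Level} (R : CommutativeRing c ℓ) where
  open CommutativeRing R hiding (zero)
  open Algebra.Properties.Ring ring using (-‿distribˡ-*; -‿distribʳ-*; -0#≈0#; -‿involutive)
  open Algebra.Properties.AbelianGroup +-abelianGroup using (⁻¹-∙-comm)
  open Relation.Binary.Reasoning.Setoid setoid

  fromℤ : ℤ.ℤ → Carrier
  fromℤ (ℤ.+ n)      = fromℕ R n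
  fromℤ (ℤ.-[1+ n ]) = - fromℕ R (suc n)

  fromℕ-+ : ∀ m n → fromℕ R (m ℕ.+ n) ≈ fromℕ R m + fromℕ R n
  fromℕ-+ zero    n = sym (+-identityˡ _)
  fromℕ-+ (suc m) n = trans (+-congˡ (fromℕ-+ m n)) (sym (+-assoc _ _ _))

  fromℕ-* : ∀ m n → fromℕ R (m ℕ.* n) ≈ fromℕ R m * fromℕ R n
  fromℕ-* zero    n = sym (zeroˡ _)
  fromℕ-* (suc m) n = begin
    fromℕ R (n ℕ.+ m ℕ.* n)                       ≈⟨ fromℕ-+ n (m ℕ.* n) ⟩
    fromℕ R n + fromℕ R (m ℕ.* n)                 ≈⟨ +-cong (sym (*-identityˡ _)) (fromℕ-* m n) ⟩
    1# * fromℕ R n + fromℕ R m * fromℕ R n        ≈⟨ distribʳ _ _ _ ⟨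
    (1# + fromℕ R m) * fromℕ R n                  ∎

  fromℤ-neg : ∀ i → fromℤ (ℤ.- i) ≈ - fromℤ i
  fromℤ-neg (ℤ.+ zero)   = sym -0#≈0#
  fromℤ-neg (ℤ.+ suc n)  = refl
  fromℤ-neg ℤ.-[1+ n ]   = sym (-‿involutive _)

  fromℤ-⊖ : ∀ m n → fromℤ (m ℤ.⊖ n) ≈ fromℕ R m - fromℕ R n
  fromℤ-⊖ zero    zero    = sym (-‿inverseʳ _)
  fromℤ-⊖ zero    (suc n) = sym (+-identityˡ _)
  fromℤ-⊖ (suc m) zero    = sym (trans (+-congˡ -0#≈0#) (+-identityʳ _))
  fromℤ-⊖ (suc m) (suc n) = begin
    fromℤ (suc m ℤ.⊖ suc n)                ≡⟨ ≡.cong fromℤ (ℤ.[1+m]⊖[1+n]≡m⊖n m n) ⟩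
    fromℤ (m ℤ.⊖ n)                        ≈⟨ fromℤ-⊖ m n ⟩
    x - y                                  ≈⟨ +-congʳ (+-identityˡ _) ⟨
    0# + x - y                             ≈⟨ +-congʳ (+-congʳ (-‿inverseʳ 1#)) ⟨
    1# - 1# + x - y                        ≈⟨ +-congʳ (trans (+-assoc _ _ _) (trans (+-congˡ (+-comm _ _)) (sym (+-assoc _ _ _)))) ⟩
    1# + x - 1# - y                        ≈⟨ +-assoc _ _ _ ⟩
    1# + x + (- 1# - y)                    ≈⟨ +-congˡ (⁻¹-∙-comm 1# y) ⟩
    1# + x - (1# + y)                      ∎
    where
    x = fromℕ R m
    y = fromℕ R n

  fromℤ-+ : ∀ i j → fromℤ (i ℤ.+ j) ≈ fromℤ i + fromℤ j
  fromℤ-+ (ℤ.+ m)    (ℤ.+ n)    = fromℕ-+ m n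
  fromℤ-+ (ℤ.+ m)    ℤ.-[1+ n ] = fromℤ-⊖ m (suc n)
  fromℤ-+ ℤ.-[1+ m ] (ℤ.+ n)    = trans (fromℤ-⊖ n (suc m)) (+-comm _ _)
  fromℤ-+ ℤ.-[1+ m ] ℤ.-[1+ n ] = begin
    - fromℕ R (suc (suc (m ℕ.+ n)))           ≈⟨ -‿cong (+-congˡ (fromℕ-+ (suc m) n)) ⟩
    - (1# + (fromℕ R (suc m) + fromℕ R n))    ≈⟨ -‿cong (trans (sym (+-assoc _ _ _)) (trans (+-congʳ (+-comm _ _)) (+-assoc _ _ _))) ⟩
    - (fromℕ R (suc m) + fromℕ R (suc n))     ≈⟨ ⁻¹-∙-comm _ _ ⟨
    - fromℕ R (suc m) - fromℕ R (suc n)       ∎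

  fromℤ-+* : ∀ m j → fromℤ (ℤ.+ m ℤ.* j) ≈ fromℕ R m * fromℤ j
  fromℤ-+* m (ℤ.+ n) = begin
    fromℤ (ℤ.+ m ℤ.* ℤ.+ n)   ≡⟨ ≡.cong fromℤ (ℤ.pos-* m n) ⟨
    fromℕ R (m ℕ.* n)         ≈⟨ fromℕ-* m n ⟩
    fromℕ R m * fromℕ R n     ∎
  fromℤ-+* m ℤ.-[1+ n ] = begin
    fromℤ (ℤ.+ m ℤ.* (ℤ.- (ℤ.+ suc n)))   ≡⟨ ≡.cong fromℤ (ℤ.neg-distribʳ-* (ℤ.+ m) (ℤ.+ suc n)) ⟨
    fromℤ (ℤ.- (ℤ.+ m ℤ.* ℤ.+ suc n))     ≈⟨ fromℤ-neg (ℤ.+ m ℤ.* ℤ.+ suc n) ⟩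
    - fromℤ (ℤ.+ m ℤ.* ℤ.+ suc n)         ≈⟨ -‿cong (fromℤ-+* m (ℤ.+ suc n)) ⟩
    - (fromℕ R m * fromℕ R (suc n))       ≈⟨ -‿distribʳ-* _ _ ⟩
    fromℕ R m * - fromℕ R (suc n)         ∎

  fromℤ-* : ∀ i j → fromℤ (i ℤ.* j) ≈ fromℤ i * fromℤ j
  fromℤ-* (ℤ.+ m)    j = fromℤ-+* m j
  fromℤ-* ℤ.-[1+ m ] j = begin
    fromℤ ((ℤ.- (ℤ.+ suc m)) ℤ.* j)       ≡⟨ ≡.cong fromℤ (ℤ.neg-distribˡ-* (ℤ.+ suc m) j) ⟨
    fromℤ (ℤ.- (ℤ.+ suc m ℤ.* j))         ≈⟨ fromℤ-neg (ℤ.+ suc m ℤ.* j) ⟩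
    - fromℤ (ℤ.+ suc m ℤ.* j)             ≈⟨ -‿cong (fromℤ-+* (suc m) j) ⟩
    - (fromℕ R (suc m) * fromℤ j)         ≈⟨ -‿distribˡ-* _ _ ⟩
    - fromℕ R (suc m) * fromℤ j           ∎

  -- Unlike fromℤ, sends 1 to 1# itself, so that solver equations can mention 1#.
  ⟦_⟧ : ℤ.ℤ → Carrier
  ⟦ ℤ.+ 1 ⟧ = 1#
  ⟦ i ⟧     = fromℤ i

  ⟦⟧≈fromℤ : ∀ i → ⟦ i ⟧ ≈ fromℤ i
  ⟦⟧≈fromℤ (ℤ.+ 0)             = refl
  ⟦⟧≈fromℤ (ℤ.+ 1)             = sym (+-identityʳ 1#)
  ⟦⟧≈fromℤ (ℤ.+ suc (suc n))   = refl
  ⟦⟧≈fromℤ ℤ.-[1+ n ]          = refl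

  morphism : ℤ.+-*-rawRing -Raw-AlmostCommutative⟶ fromCommutativeRing R
  morphism = record
    { ⟦_⟧    = ⟦_⟧
    ; +-homo = λ i j → trans (⟦⟧≈fromℤ (i ℤ.+ j)) (trans (fromℤ-+ i j) (sym (+-cong (⟦⟧≈fromℤ i) (⟦⟧≈fromℤ j))))
    ; *-homo = λ i j → trans (⟦⟧≈fromℤ (i ℤ.* j)) (trans (fromℤ-* i j) (sym (*-cong (⟦⟧≈fromℤ i) (⟦⟧≈fromℤ j))))
    ; -‿homo = λ i → trans (⟦⟧≈fromℤ (ℤ.- i)) (trans (fromℤ-neg i) (-‿cong (sym (⟦⟧≈fromℤ i))))
    ; 0-homo = refl
    ; 1-homo = refl
    }

  _coeff≟_ : ∀ i j → Maybe (⟦ i ⟧ ≈ ⟦ j ⟧)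
  i coeff≟ j with i ℤ.≟ j
  ... | yes i≡j = just (reflexive (≡.cong ⟦_⟧ i≡j))
  ... | no _    = nothing

  open Algebra.Solver.Ring ℤ.+-*-rawRing (fromCommutativeRing R) morphism _coeff≟_ public
    using (solve; con; _:+_; _:*_; _:-_; :-_; _:=_; Polynomial)

  :0 :1 :2 : ∀ {n} → Polynomial n
  :0 = con (ℤ.+ 0)
  :1 = con (ℤ.+ 1)
  :2 = con (ℤ.+ 2)

-- Built on `does`, so that it computes under a `with` on `a ≟ k` and can also be rewritten by
-- `at-same` and `at-other` where no case split is wanted.
at : ∀ {a} {A : Set a} {n} → Fin n → A → A → Fin n → A
at k x y a = if does (a ≟ k) then x else y

at-same : ∀ {a} {A : Set a} {n} (k : Fin n) {x y : A} → at k x y k ≡ x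
at-same k {x} {y} = ≡.cong (if_then x else y) (dec-true (k ≟ k) ≡.refl)

at-other : ∀ {a} {A : Set a} {n} {k i : Fin n} {x y : A} → i ≢ k → at k x y i ≡ y
at-other {k = k} {i} {x} {y} i≢k = ≡.cong (if_then x else y) (dec-false (i ≟ k) i≢k)

-- Finite sums and products

module FiniteSums {c ℓ : Level} (R : CommutativeRing c ℓ) where
  open CommutativeRing R hiding (zero)
  open IntegerSolver R
  open Relation.Binary.Reasoning.Setoid setoid
  private module Sum = Algebra.Properties.CommutativeMonoid.Sum +-commutativeMonoid

  δ : ∀ {n} → Fin n → Fin n → Carrier
  δ a = at a 1# 0#

  δ-same : ∀ {n} (a : Fin n) → δ a a ≈ 1#
  δ-same a = reflexive (at-same a)

  δ-other : ∀ {n} {a b : Fin n} → b ≢ a → δ a b ≈ 0#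
  δ-other b≢a = reflexive (at-other b≢a)

  δ-sym : ∀ {n} (a b : Fin n) → δ a b ≈ δ b a
  δ-sym a b with a ≟ b
  ... | yes ≡.refl = δ-same a
  ... | no a≢b     = δ-other (a≢b ∘ ≡.sym)

  sum-cong : ∀ {n} {f g : Fin n → Carrier} → (∀ i → f i ≈ g i) → sumFin R n f ≈ sumFin R n g
  sum-cong {zero}  f≈g = refl
  sum-cong {suc n} f≈g = +-cong (f≈g zero) (sum-cong (λ i → f≈g (suc i)))

  sumFin≡sum : ∀ {n} (f : Fin n → Carrier) → sumFin R n f ≡ Sum.sum f
  sumFin≡sum {zero}  f = ≡.refl
  sumFin≡sum {suc n} f = ≡.cong (f zero +_) (sumFin≡sum (f ∘ suc))

  sum-+ : ∀ {n} (f g : Fin n → Carrier) → sumFin R n (λ i → f i + g i) ≈ sumFin R n f + sumFin R n g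
  sum-+ f g rewrite sumFin≡sum f | sumFin≡sum g | sumFin≡sum (λ i → f i + g i) = Sum.∑-distrib-+ f g

  sum-comm : ∀ {m n} (f : Fin m → Fin n → Carrier) →
             sumFin R m (λ i → sumFin R n (f i)) ≈ sumFin R n (λ j → sumFin R m (λ i → f i j))
  sum-comm {m} {n} f = begin
    sumFin R m (λ i → sumFin R n (f i))            ≈⟨ sum-cong (λ i → reflexive (sumFin≡sum (f i))) ⟩
    sumFin R m (λ i → Sum.sum (f i))               ≡⟨ sumFin≡sum (λ i → Sum.sum (f i)) ⟩
    Sum.sum (λ i → Sum.sum (f i))                  ≈⟨ Sum.∑-comm f ⟩
    Sum.sum (λ j → Sum.sum (λ i → f i j))          ≡⟨ sumFin≡sum (λ j → Sum.sum (λ i → f i j)) ⟨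
    sumFin R n (λ j → Sum.sum (λ i → f i j))       ≈⟨ sum-cong (λ j → reflexive (sumFin≡sum (λ i → f i j))) ⟨
    sumFin R n (λ j → sumFin R m (λ i → f i j))    ∎

  sum-*ˡ : ∀ {n} x (f : Fin n → Carrier) → sumFin R n (λ i → x * f i) ≈ x * sumFin R n f
  sum-*ˡ {zero}  x f = sym (zeroʳ x)
  sum-*ˡ {suc n} x f = trans (+-congˡ (sum-*ˡ x (f ∘ suc))) (sym (distribˡ _ _ _))

  sum-0 : ∀ {n} {f : Fin n → Carrier} → (∀ i → f i ≈ 0#) → sumFin R n f ≈ 0#
  sum-0 {zero}  f≈0 = refl
  sum-0 {suc n} f≈0 = trans (+-cong (f≈0 zero) (sum-0 (λ i → f≈0 (suc i)))) (+-identityˡ 0#)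

  sum-single : ∀ {n} (k : Fin n) (f : Fin n → Carrier) → (∀ i → i ≢ k → f i ≈ 0#) → sumFin R n f ≈ f k
  sum-single zero    f f≈0 = trans (+-congˡ (sum-0 (λ i → f≈0 (suc i) (λ ())))) (+-identityʳ _)
  sum-single (suc k) f f≈0 = begin
    f zero + sumFin R _ (f ∘ suc)  ≈⟨ +-cong (f≈0 zero (λ ())) (sum-single k (f ∘ suc) (λ i i≢k → f≈0 (suc i) (i≢k ∘ Fin.suc-injective))) ⟩
    0# + f (suc k)                 ≈⟨ +-identityˡ _ ⟩
    f (suc k)                      ∎

  sum-δ : ∀ {n} (k : Fin n) (f : Fin n → Carrier) → sumFin R n (λ i → δ k i * f i) ≈ f k
  sum-δ k f = begin
    sumFin R _ (λ i → δ k i * f i)  ≈⟨ sum-single k _ (λ i i≢k → trans (*-congʳ (δ-other i≢k)) (zeroˡ _)) ⟩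
    δ k k * f k                     ≈⟨ *-congʳ (δ-same k) ⟩
    1# * f k                        ≈⟨ *-identityˡ _ ⟩
    f k                             ∎

  prod-cong : ∀ {n} {f g : Fin n → Carrier} → (∀ i → f i ≈ g i) → prodFin R n f ≈ prodFin R n g
  prod-cong {zero}  f≈g = refl
  prod-cong {suc n} f≈g = *-cong (f≈g zero) (prod-cong (λ i → f≈g (suc i)))

  prod-* : ∀ {n} (f g : Fin n → Carrier) → prodFin R n (λ i → f i * g i) ≈ prodFin R n f * prodFin R n g
  prod-* {zero}  f g = sym (*-identityˡ 1#)
  prod-* {suc n} f g = begin
    f zero * g zero * prodFin R n (λ i → f (suc i) * g (suc i))
      ≈⟨ *-congˡ (prod-* (f ∘ suc) (g ∘ suc)) ⟩
    f zero * g zero * (prodFin R n (f ∘ suc) * prodFin R n (g ∘ suc))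
      ≈⟨ solve 4 (λ a b c d → a :* b :* (c :* d) := a :* c :* (b :* d)) refl _ _ _ _ ⟩
    f zero * prodFin R n (f ∘ suc) * (g zero * prodFin R n (g ∘ suc)) ∎

-- Determinants: multilinearity and alternation

module Determinant {c ℓ : Level} (R : CommutativeRing c ℓ) where
  open CommutativeRing R hiding (zero)
  open IntegerSolver R
  open FiniteSums R
  open Relation.Binary.Reasoning.Setoid setoid

  Matrix : ℕ → Set c
  Matrix n = Fin n → Fin n → Carrier

  sgn : ∀ {n} → Fin n → Carrier
  sgn i = pow R (- 1#) (toℕ i)

  minor : ∀ {n} → Matrix (suc n) → Fin (suc n) → Matrix n
  minor A j a b = A (suc a) (punchIn j b)

  term : ∀ {n} → Matrix (suc n) → Fin (suc n) → Carrier
  term {n} A j = sgn j * A zero j * det R n (minor A j)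

  det-cong : ∀ {n} {A B : Matrix n} → (∀ a b → A a b ≈ B a b) → det R n A ≈ det R n B
  det-cong {zero}  A≈B = refl
  det-cong {suc n} {A} {B} A≈B = sum-cong {f = term A} {term B} λ j →
    *-cong (*-congˡ (A≈B zero j)) (det-cong (λ a b → A≈B (suc a) (punchIn j b)))

  -- In each summand of the expansion, row zero enters only through its entry and every other row
  -- only through the minor. So linearity in row zero is visible at once, and linearity in a later
  -- row comes from the minors by recursion.
  det-linear : ∀ {n} (A B C : Matrix n) k x y → (∀ b → C k b ≈ x * A k b + y * B k b) →
               (∀ a → a ≢ k → ∀ b → C a b ≈ A a b) → (∀ a → a ≢ k → ∀ b → C a b ≈ B a b) →
               det R n C ≈ x * det R n A + y * det R n B
  det-linear {suc n} A B C k x y Ck CA CB = begin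
    sumFin R (suc n) (term C)
      ≈⟨ sum-cong (expand k Ck CA CB) ⟩
    sumFin R (suc n) (λ j → x * term A j + y * term B j)
      ≈⟨ sum-+ (λ j → x * term A j) (λ j → y * term B j) ⟩
    sumFin R (suc n) (λ j → x * term A j) + sumFin R (suc n) (λ j → y * term B j)
      ≈⟨ +-cong (sum-*ˡ x (term A)) (sum-*ˡ y (term B)) ⟩
    x * det R (suc n) A + y * det R (suc n) B ∎
    where
    expand : ∀ k → (∀ b → C k b ≈ x * A k b + y * B k b) →
             (∀ a → a ≢ k → ∀ b → C a b ≈ A a b) → (∀ a → a ≢ k → ∀ b → C a b ≈ B a b) →
             ∀ j → term C j ≈ x * term A j + y * term B j
    expand zero Ck CA CB j = begin
      sgn j * C zero j * det R n (minor C j)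
        ≈⟨ *-congʳ (*-congˡ (Ck j)) ⟩
      sgn j * (x * A zero j + y * B zero j) * det R n (minor C j)
        ≈⟨ solve 6 (λ s x a y b d → s :* (x :* a :+ y :* b) :* d := x :* (s :* a :* d) :+ y :* (s :* b :* d)) refl
             (sgn j) x (A zero j) y (B zero j) (det R n (minor C j)) ⟩
      x * (sgn j * A zero j * det R n (minor C j)) + y * (sgn j * B zero j * det R n (minor C j))
        ≈⟨ +-cong (*-congˡ (*-congˡ (det-cong (λ a b → CA (suc a) (λ ()) _)))) (*-congˡ (*-congˡ (det-cong (λ a b → CB (suc a) (λ ()) _)))) ⟩
      x * term A j + y * term B j ∎
    expand (suc k) Ck CA CB j = begin
      sgn j * C zero j * det R n (minor C j)
        ≈⟨ *-congˡ (det-linear (minor A j) (minor B j) (minor C j) k x y (λ b → Ck _)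
             (λ a a≢k b → CA (suc a) (a≢k ∘ Fin.suc-injective) _) (λ a a≢k b → CB (suc a) (a≢k ∘ Fin.suc-injective) _)) ⟩
      sgn j * C zero j * (x * det R n (minor A j) + y * det R n (minor B j))
        ≈⟨ solve 6 (λ s c x a y b → s :* c :* (x :* a :+ y :* b) := x :* (s :* c :* a) :+ y :* (s :* c :* b)) refl
             (sgn j) (C zero j) x (det R n (minor A j)) y (det R n (minor B j)) ⟩
      x * (sgn j * C zero j * det R n (minor A j)) + y * (sgn j * C zero j * det R n (minor B j))
        ≈⟨ +-cong (*-congˡ (*-congʳ (*-congˡ (CA zero (λ ()) j)))) (*-congˡ (*-congʳ (*-congˡ (CB zero (λ ()) j)))) ⟩
      x * term A j + y * term B j ∎

  setRow : ∀ {n} → Matrix n → Fin n → (Fin n → Carrier) → Matrix n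
  setRow A k v a = at k v (A a) a

  setRow-same : ∀ {n} (A : Matrix n) k {v} b → setRow A k v k b ≈ v b
  setRow-same A k {v} b = reflexive (≡.cong (λ r → r b) (at-same k {v} {A k}))

  setRow-other : ∀ {n} (A : Matrix n) {k v a} → a ≢ k → ∀ b → setRow A k v a b ≈ A a b
  setRow-other A {k} {v} {a} a≢k b = reflexive (≡.cong (λ r → r b) (at-other {x = v} {A a} a≢k))

  det-+ : ∀ {n} (A B C : Matrix n) k → (∀ b → C k b ≈ A k b + B k b) →
          (∀ a → a ≢ k → ∀ b → C a b ≈ A a b) → (∀ a → a ≢ k → ∀ b → C a b ≈ B a b) →
          det R n C ≈ det R n A + det R n B
  det-+ A B C k Ck CA CB = trans
    (det-linear A B C k 1# 1# (λ b → trans (Ck b) (sym (+-cong (*-identityˡ _) (*-identityˡ _)))) CA CB)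
    (+-cong (*-identityˡ _) (*-identityˡ _))

  -- Polarization: expand the determinant whose rows k and l are both u + v.
  swap-of-vanishing : ∀ {n} {k l : Fin n} → k ≢ l →
    (∀ B → (∀ b → B k b ≈ B l b) → det R n B ≈ 0#) →
    ∀ A u v → det R n (setRow (setRow A k u) l v) + det R n (setRow (setRow A k v) l u) ≈ 0#
  swap-of-vanishing {n} {k} {l} k≢l vanish A u v = begin
    D u v + D v u                            ≈⟨ solve 2 (λ x y → x :+ y := (:0 :+ x) :+ (y :+ :0)) refl _ _ ⟩
    (0# + D u v) + (D v u + 0#)              ≈⟨ +-cong (+-congʳ (D-diag u)) (+-congˡ (D-diag v)) ⟨
    (D u u + D u v) + (D v u + D v v)        ≈⟨ +-cong (D-+ʳ u) (D-+ʳ v) ⟨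
    D u (u +ᵛ v) + D v (u +ᵛ v)              ≈⟨ D-+ˡ ⟨
    D (u +ᵛ v) (u +ᵛ v)                      ≈⟨ D-diag _ ⟩
    0#                                       ∎
    where
    _+ᵛ_ : (Fin n → Carrier) → (Fin n → Carrier) → Fin n → Carrier
    (x +ᵛ y) b = x b + y b
    M : (Fin n → Carrier) → (Fin n → Carrier) → Matrix n
    M x y = setRow (setRow A k x) l y
    D : (Fin n → Carrier) → (Fin n → Carrier) → Carrier
    D x y = det R n (M x y)
    rowₖ : ∀ x y b → M x y k b ≈ x b
    rowₖ x y b = trans (setRow-other (setRow A k x) k≢l b) (setRow-same A k b)
    rowₗ : ∀ x y b → M x y l b ≈ y b
    rowₗ x y b = setRow-same (setRow A k x) l b
    D-diag : ∀ x → D x x ≈ 0#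
    D-diag x = vanish _ (λ b → trans (rowₖ x x b) (sym (rowₗ x x b)))
    D-+ʳ : ∀ x → D x (u +ᵛ v) ≈ D x u + D x v
    D-+ʳ x = det-+ _ _ _ l
      (λ b → trans (rowₗ x _ b) (sym (+-cong (rowₗ x u b) (rowₗ x v b))))
      (λ a a≢l b → trans (setRow-other (setRow A k x) a≢l b) (sym (setRow-other (setRow A k x) a≢l b)))
      (λ a a≢l b → trans (setRow-other (setRow A k x) a≢l b) (sym (setRow-other (setRow A k x) a≢l b)))
    other : ∀ x y z a → a ≢ k → ∀ b → M x z a b ≈ M y z a b
    other x y z a a≢k b with a ≟ l
    ... | yes _ = refl
    ... | no _ = trans (setRow-other A a≢k b) (sym (setRow-other A a≢k b))
    D-+ˡ : D (u +ᵛ v) (u +ᵛ v) ≈ D u (u +ᵛ v) + D v (u +ᵛ v)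
    D-+ˡ = det-+ _ _ _ k
      (λ b → trans (rowₖ _ _ b) (sym (+-cong (rowₖ u _ b) (rowₖ v _ b))))
      (other _ _ _) (other _ _ _)

  -- Symmetry of G (punched indices): G j k depends only on the unordered pair {j, punchIn j k}.
  Symmetric₂ : ∀ N → (Fin (suc N) → Fin N → Carrier) → Set ℓ
  Symmetric₂ zero    G = ⊤
  Symmetric₂ (suc N) G = (∀ k → G zero k ≈ G (suc k) zero) × Symmetric₂ N (λ j k → G (suc j) (suc k))

  -- The double expansion along two equal rows `x`. Pairs whose first column is zero (`O`) cancel
  -- pairs whose second column is zero (`P`), the position of the other column shifting by one and
  -- so changing the sign. In the remaining pairs (`Q`) both signs shift, and they form the same sum
  -- with one column less.
  cancel₂ : ∀ N (x : Fin (suc N) → Carrier) G → Symmetric₂ N G →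
    sumFin R (suc N) (λ j → sgn j * x j * sumFin R N (λ k → sgn k * x (punchIn j k) * G j k)) ≈ 0#
  cancel₂ zero x G _ = solve 1 (λ y → :1 :* y :* :0 :+ :0 := :0) refl _
  cancel₂ (suc N) x G (G₀ , G₊) = begin
    1# * x zero * sumFin R (suc N) (λ k → sgn k * x (suc k) * G zero k)
      + sumFin R (suc N) (λ j → - 1# * sgn j * x (suc j) * (1# * x zero * G (suc j) zero + T j))
      ≈⟨ +-cong (sym (sum-*ˡ (1# * x zero) (λ k → sgn k * x (suc k) * G zero k))) (sum-cong {g = λ j → P j + Q j} +-body) ⟩
    sumFin R (suc N) O + sumFin R (suc N) (λ j → P j + Q j)
      ≈⟨ +-congˡ (sum-+ P Q) ⟩
    sumFin R (suc N) O + (sumFin R (suc N) P + sumFin R (suc N) Q)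
      ≈⟨ +-assoc _ _ _ ⟨
    sumFin R (suc N) O + sumFin R (suc N) P + sumFin R (suc N) Q
      ≈⟨ +-cong (trans (sym (sum-+ O P)) (sum-0 cancel)) rest ⟩
    0# + 0#
      ≈⟨ +-identityˡ 0# ⟩
    0# ∎
    where
    T O P Q : Fin (suc N) → Carrier
    O k = 1# * x zero * (sgn k * x (suc k) * G zero k)
    T j = sumFin R N (λ k → - 1# * sgn k * x (suc (punchIn j k)) * G (suc j) (suc k))
    P j = - 1# * sgn j * x (suc j) * (1# * x zero * G (suc j) zero)
    Q j = sgn j * x (suc j) * sumFin R N (λ k → sgn k * x (suc (punchIn j k)) * G (suc j) (suc k))
    +-body : ∀ j → - 1# * sgn j * x (suc j) * (1# * x zero * G (suc j) zero + T j) ≈ P j + Q j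
    +-body j = begin
      - 1# * sgn j * x (suc j) * (1# * x zero * G (suc j) zero + T j)
        ≈⟨ distribˡ _ _ _ ⟩
      P j + - 1# * sgn j * x (suc j) * T j
        ≈⟨ +-congˡ (*-congˡ (trans
             (sum-cong (λ k → solve 3 (λ s y g → :- :1 :* s :* y :* g := :- :1 :* (s :* y :* g)) refl (sgn k) (x (suc (punchIn j k))) (G (suc j) (suc k))))
             (sum-*ˡ (- 1#) (λ k → sgn k * x (suc (punchIn j k)) * G (suc j) (suc k))))) ⟩
      P j + - 1# * sgn j * x (suc j) * (- 1# * S)
        ≈⟨ +-congˡ (solve 3 (λ s y t → :- :1 :* s :* y :* (:- :1 :* t) := s :* y :* t) refl (sgn j) (x (suc j)) S) ⟩
      P j + Q j ∎
      where S = sumFin R N (λ k → sgn k * x (suc (punchIn j k)) * G (suc j) (suc k))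
    cancel : ∀ k → 1# * x zero * (sgn k * x (suc k) * G zero k) + P k ≈ 0#
    cancel k = trans (+-congʳ (*-congˡ (*-congˡ (G₀ k))))
      (solve 4 (λ y s z g → :1 :* y :* (s :* z :* g) :+ :- :1 :* s :* z :* (:1 :* y :* g) := :0) refl (x zero) (sgn k) (x (suc k)) (G (suc k) zero))
    rest : sumFin R (suc N) Q ≈ 0#
    rest = cancel₂ N (x ∘ suc) (λ j k → G (suc j) (suc k)) G₊

  -- Removing two columns leaves the same columns in the same order whichever goes first. `H` is an
  -- arbitrary function of the embedding of the remaining columns, so that the recursion can pass to
  -- embeddings `lift f` that keep column zero.
  symmetric₂-punchIn : ∀ n (H : (Fin n → Fin (suc (suc n))) → Carrier) → (∀ {f g} → f ≗ g → H f ≈ H g) →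
    Symmetric₂ (suc n) (λ j k → H (λ b → punchIn j (punchIn k b)))
  symmetric₂-punchIn zero H H-cong = (λ k → H-cong (λ ())) , tt
  symmetric₂-punchIn (suc n) H H-cong = (λ k → H-cong {λ b → punchIn zero (punchIn k b)} {λ b → punchIn (suc k) (punchIn zero b)} (λ b → ≡.refl)) ,
    symmetric₂-cong (suc n)
      (λ j k → H-cong {lift (λ b → punchIn j (punchIn k b))} {λ b → punchIn (suc j) (punchIn (suc k) b)} (λ { zero → ≡.refl ; (suc b) → ≡.refl }))
      (symmetric₂-punchIn n (λ f → H (lift f)) (λ {f} {g} f≗g → H-cong {lift f} {lift g} (λ { zero → ≡.refl ; (suc b) → ≡.cong suc (f≗g b) })))
    where
    lift : ∀ {m n} → (Fin m → Fin n) → Fin (suc m) → Fin (suc n)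
    lift f zero    = zero
    lift f (suc b) = suc (f b)
    symmetric₂-cong : ∀ N {G G′ : Fin (suc N) → Fin N → Carrier} → (∀ j k → G j k ≈ G′ j k) → Symmetric₂ N G → Symmetric₂ N G′
    symmetric₂-cong zero    G≈G′ _ = tt
    symmetric₂-cong (suc N) G≈G′ (G₀ , G₊) =
      (λ k → trans (sym (G≈G′ _ _)) (trans (G₀ k) (G≈G′ _ _))) , symmetric₂-cong N (λ j k → G≈G′ _ _) G₊

  det-alternating₀₁ : ∀ {n} (A : Matrix (suc (suc n))) → (∀ b → A zero b ≈ A (suc zero) b) → det R (suc (suc n)) A ≈ 0#
  det-alternating₀₁ {n} A A₀≈A₁ = begin
    det R (suc (suc n)) A
      ≈⟨ sum-cong {f = term A} (λ j → *-congˡ (sum-cong {f = term (minor A j)} (λ k → *-congʳ (*-congˡ (sym (A₀≈A₁ (punchIn j k))))))) ⟩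
    sumFin R _ (λ j → sgn j * A zero j * sumFin R _ (λ k → sgn k * A zero (punchIn j k) * H (λ b → punchIn j (punchIn k b))))
      ≈⟨ cancel₂ (suc n) (A zero) (λ j k → H (λ b → punchIn j (punchIn k b))) (symmetric₂-punchIn n H (λ f≗g → det-cong (λ a b → reflexive (≡.cong (A (suc (suc a))) (f≗g b))))) ⟩
    0# ∎
    where
    H : (Fin n → Fin (suc (suc n))) → Carrier
    H f = det R n (λ a b → A (suc (suc a)) (f b))

  det-alternating : ∀ {n} (A : Matrix n) {k l} → k ≢ l → (∀ b → A k b ≈ A l b) → det R n A ≈ 0#
  det-alternating-suc : ∀ {n} (A : Matrix (suc n)) {k l} → k ≢ l → (∀ b → A (suc k) b ≈ A (suc l) b) → det R (suc n) A ≈ 0#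
  -- If the second row is not row one, exchange it with row one. Neither of these is row zero, so
  -- alternation in them is already known from the minors and the exchange only changes the sign;
  -- afterwards the first two rows agree.
  det-alternating-zero : ∀ {n} (A : Matrix (suc n)) l → (∀ b → A zero b ≈ A (suc l) b) → det R (suc n) A ≈ 0#

  det-alternating-suc A k≢l Aₖ≈Aₗ = sum-0 {f = term A} λ j →
    trans (*-congˡ (det-alternating (minor A j) k≢l (λ b → Aₖ≈Aₗ (punchIn j b)))) (zeroʳ _)

  det-alternating-zero A zero A₀≈A₁ = det-alternating₀₁ A A₀≈A₁
  det-alternating-zero {suc n} A (suc l) A₀≈Aₗ = begin
    det R _ A                    ≈⟨ det-cong unchanged ⟩
    D (A (suc zero)) (A zero)    ≈⟨ +-identityˡ _ ⟨
    0# + D (A (suc zero)) (A zero)  ≈⟨ +-congʳ (det-alternating₀₁ (M (A zero) (A (suc zero))) (λ b → refl)) ⟨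
    D (A zero) (A (suc zero)) + D (A (suc zero)) (A zero)
      ≈⟨ swap-of-vanishing {k = suc zero} {suc (suc l)} (λ ()) (λ B → det-alternating-suc B {zero} {suc l} (λ ())) A (A zero) (A (suc zero)) ⟩
    0# ∎
    where
    M : (Fin (suc (suc n)) → Carrier) → (Fin (suc (suc n)) → Carrier) → Matrix (suc (suc n))
    M x y = setRow (setRow A (suc zero) x) (suc (suc l)) y
    D : (Fin (suc (suc n)) → Carrier) → (Fin (suc (suc n)) → Carrier) → Carrier
    D x y = det R _ (M x y)
    unchanged : ∀ a b → A a b ≈ M (A (suc zero)) (A zero) a b
    unchanged zero b = refl
    unchanged (suc zero) b = refl
    unchanged (suc (suc a)) b with a ≟ l
    ... | yes ≡.refl = sym (A₀≈Aₗ b)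
    ... | no _       = refl

  det-alternating A {zero}  {zero}  k≢l Aₖ≈Aₗ = contradiction ≡.refl k≢l
  det-alternating A {zero}  {suc l} k≢l Aₖ≈Aₗ = det-alternating-zero A l Aₖ≈Aₗ
  det-alternating A {suc k} {zero}  k≢l Aₖ≈Aₗ = det-alternating-zero A k (λ b → sym (Aₖ≈Aₗ b))
  det-alternating A {suc k} {suc l} k≢l Aₖ≈Aₗ = det-alternating-suc A (k≢l ∘ ≡.cong suc) Aₖ≈Aₗ

  -- Invariance under transposition

  infix 9 _ᵀ
  _ᵀ : ∀ {n} → Matrix n → Matrix n
  (A ᵀ) a b = A b a

  TransposeInvariant : ℕ → Set _
  TransposeInvariant n = ∀ (A : Matrix n) → det R n A ≈ det R n (A ᵀ)

  cofactor₂ : ∀ {n} → Matrix (suc (suc n)) → Fin (suc n) → Fin (suc n) → Carrier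
  cofactor₂ {n} A i j = det R n (λ a b → A (suc (punchIn i a)) (suc (punchIn j b)))

  -- Expansion along row zero and then along the first column of each minor, which transposing the
  -- minor permits. The resulting double sum is visibly symmetric in rows and columns. Invariance is
  -- needed in two sizes, for the minors and for the minors of those.
  det-expand₂ : ∀ {n} → TransposeInvariant n → TransposeInvariant (suc n) → (A : Matrix (suc (suc n))) →
    det R (suc (suc n)) A ≈ A zero zero * det R (suc n) (minor A zero)
      - sumFin R (suc n) (λ i → sumFin R (suc n) (λ j → sgn i * sgn j * A (suc i) zero * A zero (suc j) * cofactor₂ A i j))
  det-expand₂ {n} tr₀ tr₁ A = +-cong (*-congʳ (*-identityˡ _)) (begin
    sumFin R (suc n) (λ j → - 1# * sgn j * A zero (suc j) * det R (suc n) (minor A (suc j)))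
      ≈⟨ sum-cong column ⟩
    sumFin R (suc n) (λ j → - 1# * sumFin R (suc n) (λ i → summand i j))
      ≈⟨ sum-*ˡ (- 1#) (λ j → sumFin R (suc n) (λ i → summand i j)) ⟩
    - 1# * sumFin R (suc n) (λ j → sumFin R (suc n) (λ i → summand i j))
      ≈⟨ *-congˡ (sum-comm (λ j i → summand i j)) ⟩
    - 1# * sumFin R (suc n) (λ i → sumFin R (suc n) (summand i))
      ≈⟨ solve 1 (λ x → :- :1 :* x := :- x) refl _ ⟩
    - sumFin R (suc n) (λ i → sumFin R (suc n) (summand i)) ∎)
    where
    summand : Fin (suc n) → Fin (suc n) → Carrier
    summand i j = sgn i * sgn j * A (suc i) zero * A zero (suc j) * cofactor₂ A i j
    column : ∀ j → - 1# * sgn j * A zero (suc j) * det R (suc n) (minor A (suc j))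
                 ≈ - 1# * sumFin R (suc n) (λ i → summand i j)
    column j = begin
      - 1# * sgn j * A zero (suc j) * det R (suc n) (minor A (suc j))
        ≈⟨ *-congˡ (tr₁ (minor A (suc j))) ⟩
      - 1# * sgn j * A zero (suc j) * det R (suc n) (minor A (suc j) ᵀ)
        ≈⟨ *-congˡ (sum-cong {f = term (minor A (suc j) ᵀ)} {λ i → sgn i * A (suc i) zero * cofactor₂ A i j} (λ i → *-congˡ (tr₀ _))) ⟩
      - 1# * sgn j * A zero (suc j) * sumFin R (suc n) (λ i → sgn i * A (suc i) zero * cofactor₂ A i j)
        ≈⟨ solve 3 (λ s x t → :- :1 :* s :* x :* t := :- :1 :* (s :* x :* t)) refl (sgn j) (A zero (suc j)) _ ⟩
      - 1# * (sgn j * A zero (suc j) * sumFin R (suc n) (λ i → sgn i * A (suc i) zero * cofactor₂ A i j))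
        ≈⟨ *-congˡ (sum-*ˡ (sgn j * A zero (suc j)) (λ i → sgn i * A (suc i) zero * cofactor₂ A i j)) ⟨
      - 1# * sumFin R (suc n) (λ i → sgn j * A zero (suc j) * (sgn i * A (suc i) zero * cofactor₂ A i j))
        ≈⟨ *-congˡ (sum-cong {g = λ i → summand i j} (λ i → solve 5 (λ s x t y d → s :* x :* (t :* y :* d) := t :* s :* y :* x :* d) refl
             (sgn j) (A zero (suc j)) (sgn i) (A (suc i) zero) (cofactor₂ A i j))) ⟩
      - 1# * sumFin R (suc n) (λ i → summand i j) ∎

  det-transpose₂ : ∀ {n} → TransposeInvariant n → TransposeInvariant (suc n) → TransposeInvariant (suc (suc n))
  det-transpose₂ {n} tr₀ tr₁ A = begin
    det R (suc (suc n)) A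
      ≈⟨ det-expand₂ tr₀ tr₁ A ⟩
    A zero zero * det R (suc n) (minor A zero)
      - sumFin R (suc n) (λ i → sumFin R (suc n) (λ j → sgn i * sgn j * A (suc i) zero * A zero (suc j) * cofactor₂ A i j))
      ≈⟨ +-cong (*-congˡ (tr₁ (minor A zero))) (-‿cong (trans
           (sum-comm (λ i j → sgn i * sgn j * A (suc i) zero * A zero (suc j) * cofactor₂ A i j))
           (sum-cong (λ j → sum-cong (λ i → *-cong
             (solve 4 (λ s t x y → s :* t :* x :* y := t :* s :* y :* x) refl (sgn i) (sgn j) (A (suc i) zero) (A zero (suc j)))
             (tr₀ (λ a b → A (suc (punchIn i a)) (suc (punchIn j b))))))))) ⟩
    A zero zero * det R (suc n) (minor (A ᵀ) zero)
      - sumFin R (suc n) (λ i → sumFin R (suc n) (λ j → sgn i * sgn j * A zero (suc i) * A (suc j) zero * cofactor₂ (A ᵀ) i j))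
      ≈⟨ det-expand₂ tr₀ tr₁ (A ᵀ) ⟨
    det R (suc (suc n)) (A ᵀ) ∎

  det-transpose : ∀ n → TransposeInvariant n
  det-transpose zero          A = refl
  det-transpose (suc zero)    A = refl
  det-transpose (suc (suc n)) A = det-transpose₂ (det-transpose n) (det-transpose (suc n)) A

  -- Row and column operations

  det-scaleRow : ∀ {n} (A B : Matrix n) k x → (∀ b → A k b ≈ x * B k b) → (∀ a → a ≢ k → ∀ b → A a b ≈ B a b) →
                 det R n A ≈ x * det R n B
  det-scaleRow A B k x Aₖ A≈B = trans
    (det-linear B B A k x 0# Ak A≈B A≈B)
    (solve 2 (λ x d → x :* d :+ :0 :* d := x :* d) refl _ _)
    where
    Ak : ∀ b → A k b ≈ x * B k b + 0# * B k b
    Ak b = trans (Aₖ b) (solve 2 (λ x y → x :* y := x :* y :+ :0 :* y) refl _ _)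

  det-scaleRows : ∀ {n} (x : Fin n → Carrier) (A : Matrix n) →
                  det R n (λ a b → x a * A a b) ≈ prodFin R n x * det R n A
  det-scaleRows {zero}  x A = sym (*-identityˡ 1#)
  det-scaleRows {suc n} x A = begin
    det R (suc n) (λ a b → x a * A a b)
      ≈⟨ sum-cong {f = term (λ a b → x a * A a b)} {λ j → (x zero * p) * term A j} (λ j → begin
           sgn j * (x zero * A zero j) * det R n (λ a b → x (suc a) * minor A j a b)
             ≈⟨ *-congˡ (det-scaleRows (x ∘ suc) (minor A j)) ⟩
           sgn j * (x zero * A zero j) * (p * det R n (minor A j))
             ≈⟨ solve 5 (λ s x a p d → s :* (x :* a) :* (p :* d) := (x :* p) :* (s :* a :* d)) refl
                  (sgn j) (x zero) (A zero j) p (det R n (minor A j)) ⟩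
           (x zero * p) * term A j ∎) ⟩
    sumFin R (suc n) (λ j → (x zero * p) * term A j)
      ≈⟨ sum-*ˡ (x zero * p) (term A) ⟩
    x zero * p * det R (suc n) A ∎
    where p = prodFin R n (x ∘ suc)

  det-scaleColumns : ∀ {n} (x : Fin n → Carrier) (A : Matrix n) →
                     det R n (λ a b → x b * A a b) ≈ prodFin R n x * det R n A
  det-scaleColumns {n} x A = begin
    det R n (λ a b → x b * A a b)          ≈⟨ det-transpose n _ ⟩
    det R n (λ a b → x a * A b a)          ≈⟨ det-scaleRows x (A ᵀ) ⟩
    prodFin R n x * det R n (A ᵀ)          ≈⟨ *-congˡ (det-transpose n A) ⟨
    prodFin R n x * det R n A              ∎

  det-δ : ∀ n → det R n δ ≈ 1#
  det-δ zero    = refl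
  det-δ (suc n) = begin
    det R (suc n) δ                                ≈⟨ sum-single zero (term {n} δ) off ⟩
    1# * 1# * det R n (minor {n} δ zero)           ≈⟨ *-cong (*-identityˡ 1#) (trans (det-cong minor-δ) (det-δ n)) ⟩
    1# * 1#                                        ≈⟨ *-identityˡ 1# ⟩
    1#                                             ∎
    where
    off : ∀ j → j ≢ zero → term {n} δ j ≈ 0#
    off zero    j≢0 = contradiction ≡.refl j≢0
    off (suc j) _   = trans (*-congʳ (zeroʳ _)) (zeroˡ _)
    minor-δ : ∀ a b → minor {n} δ zero a b ≈ δ a b
    minor-δ a b with b ≟ a
    ... | yes _ = refl
    ... | no  _ = refl

  det-diagonal : ∀ {n} (x : Fin n → Carrier) (A : Matrix n) → (∀ a b → A a b ≈ x a * δ a b) → det R n A ≈ prodFin R n x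
  det-diagonal {n} x A A≈ = begin
    det R n A                            ≈⟨ det-cong A≈ ⟩
    det R n (λ a b → x a * δ a b)        ≈⟨ det-scaleRows x δ ⟩
    prodFin R n x * det R n δ            ≈⟨ *-congˡ (det-δ n) ⟩
    prodFin R n x * 1#                   ≈⟨ *-identityʳ _ ⟩
    prodFin R n x                        ∎

  det-sumRow : ∀ {n} N (x : Fin N → Carrier) (V : Fin N → Fin n → Carrier) (C : Matrix n) k →
    (∀ b → C k b ≈ sumFin R N (λ i → x i * V i b)) →
    det R n C ≈ sumFin R N (λ i → x i * det R n (setRow C k (V i)))
  det-sumRow zero x V C k Cₖ = trans
    (det-scaleRow C C k 0# (λ b → trans (Cₖ b) (sym (zeroˡ _))) (λ _ _ _ → refl)) (zeroˡ _)
  det-sumRow {n} (suc N) x V C k Cₖ = begin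
    det R n C
      ≈⟨ det-linear C₀ C₊ C k (x zero) 1#
           (λ b → trans (Cₖ b) (+-cong (*-congˡ (sym (setRow-same C k b))) (sym (trans (*-identityˡ _) (setRow-same C k b)))))
           (λ a a≢k b → sym (setRow-other C a≢k b)) (λ a a≢k b → sym (setRow-other C a≢k b)) ⟩
    x zero * det R n C₀ + 1# * det R n C₊
      ≈⟨ +-congˡ (trans (*-identityˡ _) (det-sumRow N (x ∘ suc) (V ∘ suc) C₊ k (setRow-same C k))) ⟩
    x zero * det R n C₀ + sumFin R N (λ i → x (suc i) * det R n (setRow C₊ k (V (suc i))))
      ≈⟨ +-congˡ (sum-cong (λ i → *-congˡ (det-cong (setRow-setRow (V (suc i)))))) ⟩
    x zero * det R n C₀ + sumFin R N (λ i → x (suc i) * det R n (setRow C k (V (suc i)))) ∎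
    where
    rest : Fin n → Carrier
    rest b = sumFin R N (λ i → x (suc i) * V (suc i) b)
    C₀ = setRow C k (V zero)
    C₊ = setRow C k rest
    setRow-setRow : ∀ v a b → setRow C₊ k v a b ≈ setRow C k v a b
    setRow-setRow v a b with a ≟ k
    ... | yes _ = refl
    ... | no _  = refl

  det-swapRows : ∀ {n} (A B : Matrix n) {k l} → k ≢ l → (∀ b → B k b ≈ A l b) → (∀ b → B l b ≈ A k b) →
    (∀ a → a ≢ k → a ≢ l → ∀ b → B a b ≈ A a b) → det R n A ≈ - det R n B
  det-swapRows {n} A B {k} {l} k≢l Bₖ Bₗ B≈A = begin
    det R n A                            ≈⟨ solve 2 (λ x y → x := x :+ y :- y) refl _ _ ⟩
    det R n A + det R n B - det R n B    ≈⟨ +-congʳ (trans (+-cong (det-cong A≈) (det-cong B≈)) (swap-of-vanishing k≢l (λ C → det-alternating C k≢l) A (A k) (A l))) ⟩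
    0# - det R n B                       ≈⟨ +-identityˡ _ ⟩
    - det R n B                          ∎
    where
    A≈ : ∀ a b → A a b ≈ setRow (setRow A k (A k)) l (A l) a b
    A≈ a b with a ≟ l
    ... | yes ≡.refl = refl
    ... | no _ with a ≟ k
    ... | yes ≡.refl = refl
    ... | no _ = refl
    B≈ : ∀ a b → B a b ≈ setRow (setRow A k (A l)) l (A k) a b
    B≈ a b with a ≟ l
    ... | yes ≡.refl = Bₗ b
    ... | no a≢l with a ≟ k
    ... | yes ≡.refl = Bₖ b
    ... | no a≢k = B≈A a a≢k a≢l b

  -- The rows of A′ = (1 + N) A are installed one at a time: in a matrix mixing rows of A and A′,
  -- replacing a row k by a lower row A c gives determinant 0, by induction on the height of c.
  module UnipotentRows {n : ℕ} (h : Fin n → ℕ) (N : Matrix n) (N≈0 : ∀ (i j : Fin n) → ¬ (h j < h i) → N i j ≈ 0#) (A : Matrix n) where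
    open Data.List.Membership.DecPropositional (_≟_ {n}) using (_∈?_)

    ΣNA : Fin n → Fin n → Carrier
    ΣNA a b = sumFin R n (λ c → N a c * A c b)

    A′ : Matrix n
    A′ a b = A a b + ΣNA a b

    mixed : List (Fin n) → Matrix n
    mixed L a = if does (a ∈? L) then A′ a else A a

    mixed-∈ : ∀ {L a} → a ∈ L → ∀ b → mixed L a b ≈ A′ a b
    mixed-∈ {L} {a} a∈L b = reflexive (≡.cong (λ z → (if z then A′ a else A a) b) (dec-true (a ∈? L) a∈L))

    mixed-∉ : ∀ {L a} → a ∉ L → ∀ b → mixed L a b ≈ A a b
    mixed-∉ {L} {a} a∉L b = reflexive (≡.cong (λ z → (if z then A′ a else A a) b) (dec-false (a ∈? L) a∉L))

    mixed-∷ : ∀ {k L a} → a ≢ k → ∀ b → mixed (k ∷ L) a b ≈ mixed L a b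
    mixed-∷ {k} {L} {a} a≢k b with a ≟ k
    ... | yes a≡k = contradiction a≡k a≢k
    ... | no _ with a ∈? L
    ... | yes _ = refl
    ... | no _  = refl

    D : List (Fin n) → Fin n → (Fin n → Carrier) → Carrier
    D L k v = det R n (setRow (mixed L) k v)

    D-repeated : ∀ L {k c v} → c ≢ k → (∀ b → mixed L c b ≈ v b) → D L k v ≈ 0#
    D-repeated L {k} {c} {v} c≢k row-c = det-alternating (setRow (mixed L) k v) (c≢k ∘ ≡.sym) λ b →
      trans (setRow-same (mixed L) k b) (sym (trans (setRow-other (mixed L) c≢k b) (row-c b)))

    D-+ : ∀ L k u v → D L k (λ b → u b + v b) ≈ D L k u + D L k v
    D-+ L k u v = det-+ _ _ _ k
      (λ b → trans (setRow-same M k b) (sym (+-cong (setRow-same M k b) (setRow-same M k b))))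
      (λ a a≢k b → trans (setRow-other M a≢k b) (sym (setRow-other M a≢k b)))
      (λ a a≢k b → trans (setRow-other M a≢k b) (sym (setRow-other M a≢k b)))
      where M = mixed L

    D-ΣNA : ∀ L k a → (∀ c → h c < h a → D L k (A c) ≈ 0#) → D L k (ΣNA a) ≈ 0#
    D-ΣNA L k a lower = trans
      (det-sumRow n (N a) A (setRow (mixed L) k (ΣNA a)) k (setRow-same (mixed L) k))
      (sum-0 λ c → trans (*-congˡ (det-cong (setRow-twice (A c)))) (vanish c))
      where
      vanish : ∀ c → N a c * D L k (A c) ≈ 0#
      vanish c with h c ℕ.<? h a
      ... | yes c<a = trans (*-congˡ (lower c c<a)) (zeroʳ _)
      ... | no c≮a  = trans (*-congʳ (N≈0 a c c≮a)) (zeroˡ _)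
      setRow-twice : ∀ v a′ b → setRow (setRow (mixed L) k (ΣNA a)) k v a′ b ≈ setRow (mixed L) k v a′ b
      setRow-twice v a′ b with a′ ≟ k
      ... | yes _ = refl
      ... | no _  = refl

    D-lower : ∀ L k c → Acc _<_ (h c) → h c < h k → D L k (A c) ≈ 0#
    D-lower L k c (acc rs) c<k with c ∈? L
    ... | no c∉L = D-repeated L (λ { ≡.refl → ℕ.<-irrefl ≡.refl c<k }) (mixed-∉ c∉L)
    ... | yes c∈L = begin
      -- Row `c` of the mixture is already `A′ c`. Adding `ΣNA c`, which contributes nothing because
      -- its rows are lower still, turns `A c` into a copy of that row.
      D L k (A c)                  ≈⟨ +-identityʳ _ ⟨
      D L k (A c) + 0#             ≈⟨ +-congˡ (D-ΣNA L k c (λ i i<c → D-lower L k i (rs i<c) (ℕ.<-trans i<c c<k))) ⟨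
      D L k (A c) + D L k (ΣNA c)  ≈⟨ D-+ L k (A c) (ΣNA c) ⟨
      D L k (A′ c)                 ≈⟨ D-repeated L (λ { ≡.refl → ℕ.<-irrefl ≡.refl c<k }) (mixed-∈ c∈L) ⟩
      0#                           ∎

    det-mixed : ∀ L → det R n (mixed L) ≈ det R n A
    det-mixed []      = refl
    det-mixed (k ∷ L) = trans install (det-mixed L)
      where
      install : det R n (mixed (k ∷ L)) ≈ det R n (mixed L)
      install with k ∈? L
      ... | yes k∈L = det-cong same
        where
        same : ∀ a b → mixed (k ∷ L) a b ≈ mixed L a b
        same a b with a ≟ k
        ... | yes ≡.refl = sym (mixed-∈ k∈L b)
        ... | no a≢k with a ∈? L
        ... | yes _ = refl
        ... | no _  = refl
      ... | no k∉L = begin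
        det R n (mixed (k ∷ L))
          ≈⟨ det-+ (mixed L) (setRow (mixed L) k (ΣNA k)) (mixed (k ∷ L)) k
               (λ b → trans (mixed-∈ {k ∷ L} (here ≡.refl) b) (+-cong (sym (mixed-∉ k∉L b)) (sym (setRow-same (mixed L) k b))))
               (λ a a≢k → mixed-∷ {L = L} a≢k)
               (λ a a≢k b → trans (mixed-∷ {L = L} a≢k b) (sym (setRow-other (mixed L) a≢k b))) ⟩
        det R n (mixed L) + D L k (ΣNA k)
          ≈⟨ +-congˡ (D-ΣNA L k k (λ c → D-lower L k c (<-wellFounded _))) ⟩
        det R n (mixed L) + 0#
          ≈⟨ +-identityʳ _ ⟩
        det R n (mixed L) ∎

    det-unipotentRows : det R n A′ ≈ det R n A
    det-unipotentRows = trans (det-cong (λ a b → sym (mixed-∈ (∈-allFin a) b))) (det-mixed (allFin n))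

  open UnipotentRows public using (det-unipotentRows)

  det-unipotentColumns : ∀ {n} (h : Fin n → ℕ) (N : Matrix n) → (∀ a c → ¬ (h c < h a) → N a c ≈ 0#) → (A : Matrix n) →
    det R n (λ a b → A a b + sumFin R n (λ c → N b c * A a c)) ≈ det R n A
  det-unipotentColumns {n} h N N≈0 A = begin
    det R n (λ a b → A a b + sumFin R n (λ c → N b c * A a c))   ≈⟨ det-transpose n _ ⟩
    det R n (λ a b → A b a + sumFin R n (λ c → N a c * A b c))   ≈⟨ det-unipotentRows h N N≈0 (A ᵀ) ⟩
    det R n (A ᵀ)                                                ≈⟨ det-transpose n A ⟨
    det R n A                                                    ∎

  -- A substitute for deleting row `k` and column `l` that keeps the index set: its determinant is
  -- the cofactor at `k`, `l`, sign included.
  clear : ∀ {n} → Fin n → Fin n → Matrix n → Matrix n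
  clear k l A a b = at k (δ l b) (at l 0# (A a b) b) a

  det-unitRow : ∀ {n} (A : Matrix n) k l s → (∀ b → A k b ≈ s * δ l b) → det R n A ≈ s * det R n (clear k l A)
  det-unitRow {n} A k l s Aₖ = begin
    det R n A                      ≈⟨ det-scaleRow A B k s (λ b → trans (Aₖ b) (*-congˡ (sym (setRow-same A k b)))) (λ a a≢k b → sym (setRow-other A a≢k b)) ⟩
    s * det R n B                  ≈⟨ *-congˡ (trans (sym (det-unipotentRows h N N≈0 B)) (det-cong cleared)) ⟩
    s * det R n (clear k l A)      ∎
    where
    B = setRow A k (δ l)
    -- Two levels suffice, since the only row added to others is row `k`, now a unit vector; it
    -- clears column `l`.
    h : Fin n → ℕ
    h = at k 0 1
    N : Matrix n
    N a c = at k 0# (- A a l) a * δ k c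
    N≈0 : ∀ a c → ¬ (h c < h a) → N a c ≈ 0#
    N≈0 a c c≮a with c ≟ k | a ≟ k
    ... | no _  | _     = zeroʳ _
    ... | yes _ | yes _ = zeroˡ _
    ... | yes _ | no _  = contradiction (s≤s z≤n) c≮a
    Σ-collapse : ∀ a b → sumFin R n (λ c → N a c * B c b) ≈ at k 0# (- A a l) a * δ l b
    Σ-collapse a b = begin
      sumFin R n (λ c → x * δ k c * B c b)      ≈⟨ sum-cong (λ c → *-assoc x (δ k c) (B c b)) ⟩
      sumFin R n (λ c → x * (δ k c * B c b))    ≈⟨ sum-*ˡ x (λ c → δ k c * B c b) ⟩
      x * sumFin R n (λ c → δ k c * B c b)      ≈⟨ *-congˡ (trans (sum-δ k (λ c → B c b)) (setRow-same A k b)) ⟩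
      x * δ l b                                 ∎
      where x = at k 0# (- A a l) a
    cleared : ∀ a b → B a b + sumFin R n (λ c → N a c * B c b) ≈ clear k l A a b
    cleared a b = trans (+-congˡ (Σ-collapse a b)) entry
      where
      entry : B a b + at k 0# (- A a l) a * δ l b ≈ clear k l A a b
      entry with a ≟ k
      ... | yes _ = trans (+-congˡ (zeroˡ _)) (+-identityʳ _)
      ... | no _ with b ≟ l
      ... | yes ≡.refl = solve 1 (λ x → x :+ :- x :* :1 := :0) refl _
      ... | no _       = solve 2 (λ x y → x :+ :- y :* :0 := x) refl _ _

  det-unitColumn : ∀ {n} (A : Matrix n) k l s → (∀ a → A a k ≈ s * δ l a) →
                   det R n A ≈ s * det R n (clear k l (A ᵀ) ᵀ)
  det-unitColumn {n} A k l s Aₖ = begin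
    det R n A                            ≈⟨ det-transpose n A ⟩
    det R n (A ᵀ)                        ≈⟨ det-unitRow (A ᵀ) k l s Aₖ ⟩
    s * det R n (clear k l (A ᵀ))        ≈⟨ *-congˡ (det-transpose n _) ⟩
    s * det R n (clear k l (A ᵀ) ᵀ)      ∎

  -- The additions are simultaneous, each using the original row `π a`. The height may fail to drop
  -- only where `x a` vanishes; this is how the root, which is its own parent, is exempted.
  det-addRows : ∀ {n} (h : Fin n → ℕ) (x : Fin n → Carrier) (π : Fin n → Fin n) → (∀ a → ¬ (h (π a) < h a) → x a ≈ 0#) →
    ∀ (A : Matrix n) → det R n (λ a b → A a b + x a * A (π a) b) ≈ det R n A
  det-addRows {n} h x π x≈0 A = trans (det-cong (λ a b → +-congˡ (collapse a b))) (det-unipotentRows h N N≈0 A)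
    where
    N : Matrix n
    N a c = x a * δ (π a) c
    N≈0 : ∀ a c → ¬ (h c < h a) → N a c ≈ 0#
    N≈0 a c c≮a with c ≟ π a
    ... | yes ≡.refl = trans (*-congʳ (x≈0 a c≮a)) (zeroˡ _)
    ... | no _       = zeroʳ _
    collapse : ∀ a b → x a * A (π a) b ≈ sumFin R n (λ c → x a * δ (π a) c * A c b)
    collapse a b = sym (begin
      sumFin R n (λ c → x a * δ (π a) c * A c b)      ≈⟨ sum-cong (λ c → *-assoc (x a) (δ (π a) c) (A c b)) ⟩
      sumFin R n (λ c → x a * (δ (π a) c * A c b))    ≈⟨ sum-*ˡ {n} (x a) _ ⟩
      x a * sumFin R n (λ c → δ (π a) c * A c b)      ≈⟨ *-congˡ (sum-δ (π a) (λ c → A c b)) ⟩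
      x a * A (π a) b                                 ∎)

  det-addColumns : ∀ {n} (h : Fin n → ℕ) (x : Fin n → Carrier) (π : Fin n → Fin n) → (∀ a → ¬ (h (π a) < h a) → x a ≈ 0#) →
    ∀ (A : Matrix n) → det R n (λ a b → A a b + x b * A a (π b)) ≈ det R n A
  det-addColumns {n} h x π x≈0 A = begin
    det R n (λ a b → A a b + x b * A a (π b))    ≈⟨ det-transpose n _ ⟩
    det R n (λ a b → A b a + x a * A b (π a))    ≈⟨ det-addRows h x π x≈0 (A ᵀ) ⟩
    det R n (A ᵀ)                                ≈⟨ det-transpose n A ⟨
    det R n A                                    ∎

-- Squared distances in a rooted tree

-- The bound serves to turn heights upside down when rows of children are added to the row of their
-- parent.
maximum : ∀ {n} (h : Fin n → ℕ) → ∃ λ B → ∀ a → h a ≤ B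
maximum {zero}  h = 0 , λ ()
maximum {suc n} h with maximum (h ∘ suc)
... | B , h≤B = h zero ℕ.⊔ B , λ { zero → ℕ.m≤m⊔n _ _ ; (suc a) → ℕ.≤-trans (h≤B a) (ℕ.m≤n⊔m (h zero) B) }

module _ {c ℓ : Level} (R : CommutativeRing c ℓ) where
  open CommutativeRing R hiding (zero)
  open FiniteSums R

  -- Here q is the root, p and r are its children, W a is the weight of the edge from a to par a, and
  -- Z a b indicates that a is b or an ancestor of b. The values par q = q and W q = 1 are conventions.
  record RootedTree (n : ℕ) : Set (c ⊔ ℓ) where
    field
      q p r      : Fin n
      p≢q        : p ≢ q
      r≢q        : r ≢ q
      p≢r        : p ≢ r
      par        : Fin n → Fin n
      height     : Fin n → ℕ
      par-q      : par q ≡ q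
      par-p      : par p ≡ q
      par-r      : par r ≡ q
      par-<      : ∀ a → a ≢ q → height (par a) < height a
      height-pr  : height p ≡ height r
      children-q : ∀ a → a ≢ q → par a ≡ q → a ≡ p ⊎ a ≡ r
      W          : Fin n → Carrier
      d          : Fin n → Fin n → Carrier
      Z          : Fin n → Fin n → Carrier
      W-q        : W q ≈ 1#
      d-refl     : ∀ a → d a a ≈ 0#
      d-sym      : ∀ a b → d a b ≈ d b a
      d-par      : ∀ a b → a ≢ q → d a b ≈ d (par a) b + W a * (1# - fromℕ R 2 * Z a b)
      Z-root     : ∀ a → a ≢ q → Z a q ≈ 0#
      Z-par      : ∀ a b → a ≢ q → b ≢ q → Z a b ≈ Z a (par b) + δ a b

module RootedTreeDeterminant {c ℓ : Level} (R : CommutativeRing c ℓ) {n : ℕ} (T : RootedTree R n) where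
  open CommutativeRing R hiding (zero)
  open IntegerSolver R
  open FiniteSums R
  open Determinant R
  open RootedTree T
  open Relation.Binary.Reasoning.Setoid setoid

  q≢r : q ≢ r
  q≢r = r≢q ∘ ≡.sym

  2# : Carrier
  2# = fromℕ R 2

  -- The ancestor relation

  -- Descent along the parents of `b` by `Z-par`. Every vertex met after `b` is strictly closer to
  -- the root than `b`, hence never `a`, and the descent ends in `Z-root`.
  Z-later : ∀ a b → Acc _<_ (height b) → a ≢ q → ¬ (height a < height b) → a ≢ b → Z a b ≈ 0#
  Z-later a b (acc rs) a≢q a≮b a≢b with b ≟ q
  ... | yes ≡.refl = Z-root a a≢q
  ... | no b≢q = begin
    Z a b                     ≈⟨ Z-par a b a≢q b≢q ⟩
    Z a (par b) + δ a b       ≈⟨ +-cong (Z-later a (par b) (rs pb<b) a≢q (λ a<pb → a≮b (ℕ.<-trans a<pb pb<b)) (λ { ≡.refl → a≮b pb<b })) (δ-other (a≢b ∘ ≡.sym)) ⟩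
    0# + 0#                   ≈⟨ +-identityˡ 0# ⟩
    0#                        ∎
    where pb<b = par-< b b≢q

  Z-refl : ∀ a → a ≢ q → Z a a ≈ 1#
  Z-refl a a≢q = begin
    Z a a                  ≈⟨ Z-par a a a≢q a≢q ⟩
    Z a (par a) + δ a a    ≈⟨ +-cong (Z-later a (par a) (<-wellFounded _) a≢q (λ a<pa → ℕ.<-asym a<pa pa<a) (λ a≡pa → ℕ.<-irrefl (≡.cong height (≡.sym a≡pa)) pa<a)) (δ-same a) ⟩
    0# + 1#                ≈⟨ +-identityˡ 1# ⟩
    1#                     ∎
    where pa<a = par-< a a≢q

  Z-antisym : ∀ a b → a ≢ q → b ≢ q → a ≢ b → Z a b * Z b a ≈ 0#
  Z-antisym a b a≢q b≢q a≢b with height a ℕ.<? height b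
  ... | yes a<b = trans (*-congˡ (Z-later b a (<-wellFounded _) b≢q (ℕ.<-asym a<b) (a≢b ∘ ≡.sym))) (zeroʳ _)
  ... | no a≮b  = trans (*-congʳ (Z-later a b (<-wellFounded _) a≢q a≮b a≢b)) (zeroˡ _)

  Z-child-q : ∀ a b → a ≢ q → b ≢ q → par b ≡ q → Z a b ≈ δ a b
  Z-child-q a b a≢q b≢q pb≡q = begin
    Z a b                ≈⟨ Z-par a b a≢q b≢q ⟩
    Z a (par b) + δ a b  ≈⟨ +-congʳ (trans (reflexive (≡.cong (Z a) pb≡q)) (Z-root a a≢q)) ⟩
    0# + δ a b           ≈⟨ +-identityˡ _ ⟩
    δ a b                ∎

  -- Moving from `b` to its parent changes neither summand until `p` or `r` is reached, and one of
  -- them must be reached: by `children-q` the root is entered from nowhere else.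
  Z-p+Z-r : ∀ b → Acc _<_ (height b) → b ≢ q → Z p b + Z r b ≈ 1#
  Z-p+Z-r b (acc rs) b≢q with b ≟ p | b ≟ r
  ... | yes ≡.refl | _ = trans (+-cong (Z-refl p p≢q) (trans (Z-child-q r p r≢q p≢q par-p) (δ-other p≢r))) (+-identityʳ 1#)
  ... | no _ | yes ≡.refl = trans (+-cong (trans (Z-child-q p r p≢q r≢q par-r) (δ-other (p≢r ∘ ≡.sym))) (Z-refl r r≢q)) (+-identityˡ 1#)
  ... | no b≢p | no b≢r = begin
    Z p b + Z r b
      ≈⟨ +-cong (Z-par p b p≢q b≢q) (Z-par r b r≢q b≢q) ⟩
    Z p (par b) + δ p b + (Z r (par b) + δ r b)
      ≈⟨ +-cong (+-congˡ (δ-other b≢p)) (+-congˡ (δ-other b≢r)) ⟩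
    Z p (par b) + 0# + (Z r (par b) + 0#)
      ≈⟨ +-cong (+-identityʳ _) (+-identityʳ _) ⟩
    Z p (par b) + Z r (par b)
      ≈⟨ Z-p+Z-r (par b) (rs (par-< b b≢q)) (λ pb≡q → [ b≢p , b≢r ] (children-q b b≢q pb≡q)) ⟩
    1# ∎

  ch t : Fin n → Carrier
  ch a = sumFin R n (λ x → δ (par x) a)
  t a = 1# - ch a

  δ-par-q : ∀ {a} → a ≢ q → δ (par q) a ≈ 0#
  δ-par-q a≢q = δ-other (λ a≡pq → a≢q (≡.trans a≡pq par-q))

  -- Both sides indicate that `a` is a strict ancestor of `b`, the left one through the unique child
  -- of `a` on the way to `b`. In the descent, passing from `par b` to `b` adds to the sum only the
  -- term of `b` itself, present when `a` is `par b`. The root counts as its own child, which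
  -- `a ≢ q` makes harmless.
  Σ-children-Z : ∀ a b → Acc _<_ (height b) → a ≢ q → sumFin R n (λ x → δ (par x) a * Z x b) ≈ Z a b - δ a b
  Σ-children-Z a b (acc rs) a≢q with b ≟ q
  ... | yes ≡.refl = begin
    sumFin R n (λ x → δ (par x) a * Z x q)   ≈⟨ sum-0 term≈0 ⟩
    0#                                       ≈⟨ solve 0 (:0 := :0 :- :0) refl ⟩
    0# - 0#                                  ≈⟨ +-cong (Z-root a a≢q) (-‿cong (δ-other (a≢q ∘ ≡.sym))) ⟨
    Z a q - δ a q                            ∎
    where
    term≈0 : ∀ x → δ (par x) a * Z x q ≈ 0#
    term≈0 x with x ≟ q
    ... | yes ≡.refl = trans (*-congʳ (δ-par-q a≢q)) (zeroˡ _)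
    ... | no x≢q     = trans (*-congˡ (Z-root x x≢q)) (zeroʳ _)
  ... | no b≢q = begin
    sumFin R n (λ x → δ (par x) a * Z x b)
      ≈⟨ sum-cong step′ ⟩
    sumFin R n (λ x → δ (par x) a * Z x (par b) + δ b x * δ (par x) a)
      ≈⟨ sum-+ {n} _ _ ⟩
    sumFin R n (λ x → δ (par x) a * Z x (par b)) + sumFin R n (λ x → δ b x * δ (par x) a)
      ≈⟨ +-cong (Σ-children-Z a (par b) (rs (par-< b b≢q)) a≢q) (sum-δ b (λ x → δ (par x) a)) ⟩
    Z a (par b) - δ a (par b) + δ (par b) a
      ≈⟨ +-congˡ (δ-sym (par b) a) ⟩
    Z a (par b) - δ a (par b) + δ a (par b)
      ≈⟨ solve 3 (λ z x y → z :- x :+ x := z :+ y :- y) refl _ _ _ ⟩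
    Z a (par b) + δ a b - δ a b
      ≈⟨ +-congʳ (Z-par a b a≢q b≢q) ⟨
    Z a b - δ a b ∎
    where
    step′ : ∀ x → δ (par x) a * Z x b ≈ δ (par x) a * Z x (par b) + δ b x * δ (par x) a
    step′ x with x ≟ q
    ... | yes ≡.refl = trans (*-congʳ (δ-par-q a≢q)) (trans (solve 3 (λ z z′ y → :0 :* z := :0 :* z′ :+ y :* :0) refl _ _ _)
                         (sym (+-cong (*-congʳ (δ-par-q a≢q)) (*-congˡ (δ-par-q a≢q)))))
    ... | no x≢q = begin
      δ (par x) a * Z x b                                     ≈⟨ *-congˡ (Z-par x b x≢q b≢q) ⟩
      δ (par x) a * (Z x (par b) + δ x b)                     ≈⟨ *-congˡ (+-congˡ (δ-sym x b)) ⟩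
      δ (par x) a * (Z x (par b) + δ b x)                     ≈⟨ solve 3 (λ e z y → e :* (z :+ y) := e :* z :+ y :* e) refl _ _ _ ⟩
      δ (par x) a * Z x (par b) + δ b x * δ (par x) a         ∎

  H : Matrix n
  H a b = 2# * (Z a b + Z b a - δ a b) - 1#

  H-sym : ∀ a b → H a b ≈ H b a
  H-sym a b = +-congʳ (*-congˡ (+-cong (+-comm _ _) (-‿cong (δ-sym a b))))

  -- The ancestors of a child `x` of `a` are those of `a` together with `x`. So in `H x b` the `δ`
  -- cancels and `2 Z x b + (2 Z b a - 1)` remains: the first part sums by `Σ-children-Z`, the
  -- second is constant and counts the children.
  Σ-children-H : ∀ a b → a ≢ q → b ≢ q →
    sumFin R n (λ x → δ (par x) a * H x b) ≈ H a b - t a * (2# * Z b a - 1#)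
  Σ-children-H a b a≢q b≢q = begin
    sumFin R n (λ x → δ (par x) a * H x b)
      ≈⟨ sum-cong step′ ⟩
    sumFin R n (λ x → 2# * (δ (par x) a * Z x b) + (2# * Z b a - 1#) * δ (par x) a)
      ≈⟨ sum-+ {n} _ _ ⟩
    sumFin R n (λ x → 2# * (δ (par x) a * Z x b)) + sumFin R n (λ x → (2# * Z b a - 1#) * δ (par x) a)
      ≈⟨ +-cong (trans (sum-*ˡ {n} 2# _) (*-congˡ (Σ-children-Z a b (<-wellFounded _) a≢q))) (sum-*ˡ {n} (2# * Z b a - 1#) _) ⟩
    2# * (Z a b - δ a b) + (2# * Z b a - 1#) * ch a
      ≈⟨ solve 4 (λ x y e k → :2 :* (x :- e) :+ (:2 :* y :- :1) :* k := (:2 :* (x :+ y :- e) :- :1) :- (:1 :- k) :* (:2 :* y :- :1)) refl (Z a b) (Z b a) (δ a b) (ch a) ⟩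
    H a b - t a * (2# * Z b a - 1#) ∎
    where
    step′ : ∀ x → δ (par x) a * H x b ≈ 2# * (δ (par x) a * Z x b) + (2# * Z b a - 1#) * δ (par x) a
    step′ x with a ≟ par x
    ... | no _ = solve 3 (λ x y z → :0 :* x := :2 :* (:0 :* y) :+ z :* :0) refl _ _ _
    ... | yes ≡.refl with x ≟ q
    ... | yes ≡.refl = contradiction par-q a≢q
    ... | no x≢q = begin
      1# * (2# * (Z x b + Z b x - δ x b) - 1#)
        ≈⟨ *-congˡ (+-congʳ (*-congˡ (+-cong (+-congˡ (Z-par b x b≢q x≢q)) (-‿cong (δ-sym x b))))) ⟩
      1# * (2# * (Z x b + (Z b (par x) + δ b x) - δ b x) - 1#)
        ≈⟨ solve 3 (λ u v e → :1 :* (:2 :* (u :+ (v :+ e) :- e) :- :1) := :2 :* (:1 :* u) :+ (:2 :* v :- :1) :* :1) refl _ _ _ ⟩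
      2# * (1# * Z x b) + (2# * Z b (par x) - 1#) * 1# ∎

  -- Differences of squared distances along parent edges

  Δ₀ : Matrix n
  Δ₀ a b = d a b * d a b

  -- For `b` other than the root, the sum of the distances from `q` to `b` and to its parent: the
  -- cofactor of `W b` in the difference of the two squares.
  z : Fin n → Carrier
  z b = 2# * d b q - W b

  M : Matrix n
  M a b = at q (at q 0# (z b) b) (at q (z a) (- (2# * H a b)) b) a

  d-par′ : ∀ a b → a ≢ q → d (par a) b ≈ d a b - W a * (1# - 2# * Z a b)
  d-par′ a b a≢q = sym (trans (+-congʳ (d-par a b a≢q)) (solve 2 (λ x y → x :+ y :- y := x) refl _ _))

  d²-q : ∀ b → b ≢ q → Δ₀ b q - Δ₀ (par b) q ≈ W b * z b
  d²-q b b≢q = begin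
    Δ₀ b q - d (par b) q * d (par b) q
      ≈⟨ +-congˡ (-‿cong (*-cong pb pb)) ⟩
    Δ₀ b q - (d b q - W b) * (d b q - W b)
      ≈⟨ solve 2 (λ x w → x :* x :- (x :- w) :* (x :- w) := w :* (:2 :* x :- w)) refl _ _ ⟩
    W b * z b ∎
    where
    pb : d (par b) q ≈ d b q - W b
    pb = trans (d-par′ b q b≢q) (trans (+-congˡ (-‿cong (*-congˡ (+-congˡ (-‿cong (*-congˡ (Z-root b b≢q)))))))
      (solve 2 (λ x w → x :- w :* (:1 :- :2 :* :0) := x :- w) refl _ _))

  -- For `a ≢ b` the four distances are `x`, `x - α`, `x - β` and `x - α - β`, and their squares
  -- combine to twice `α * β`; the product of the two `Z` drops out because two distinct vertices
  -- are not ancestors of each other. For `a ≡ b` the pattern breaks, as `d (par a) (par a)` is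
  -- zero, and the entries are evaluated directly.
  d²-mixed : ∀ a b → a ≢ q → b ≢ q →
    Δ₀ a b - Δ₀ (par a) b - (Δ₀ a (par b) - Δ₀ (par a) (par b)) ≈ W a * (W b * (- (2# * H a b)))
  d²-mixed a b a≢q b≢q with a ≟ b
  ... | yes ≡.refl = begin
    Δ₀ a a - Δ₀ (par a) a - (Δ₀ a (par a) - Δ₀ (par a) (par a))
      ≈⟨ +-cong (+-cong (*-cong (d-refl a) (d-refl a)) (-‿cong (*-cong pa pa))) (-‿cong (+-cong (*-cong pa′ pa′) (-‿cong (*-cong (d-refl _) (d-refl _))))) ⟩
    0# * 0# - W a * W a - (W a * W a - 0# * 0#)
      ≈⟨ solve 1 (λ w → :0 :* :0 :- w :* w :- (w :* w :- :0 :* :0) := w :* (w :* (:- (:2 :* (:2 :* (:1 :+ :1 :- :1) :- :1))))) refl _ ⟩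
    W a * (W a * (- (2# * (2# * (1# + 1# - 1#) - 1#))))
      ≈⟨ *-congˡ (*-congˡ (-‿cong (*-congˡ (+-congʳ (*-congˡ (+-cong (+-cong (Z-refl a a≢q) (Z-refl a a≢q)) (-‿cong (δ-same a)))))))) ⟨
    W a * (W a * (- (2# * H a a))) ∎
    where
    pa : d (par a) a ≈ W a
    pa = trans (d-par′ a a a≢q) (trans (+-cong (d-refl a) (-‿cong (*-congˡ (+-congˡ (-‿cong (*-congˡ (Z-refl a a≢q)))))))
      (solve 1 (λ w → :0 :- w :* (:1 :- :2 :* :1) := w) refl _))
    pa′ : d a (par a) ≈ W a
    pa′ = trans (d-sym _ _) pa
  ... | no a≢b = begin
    Δ₀ a b - Δ₀ (par a) b - (Δ₀ a (par b) - Δ₀ (par a) (par b))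
      ≈⟨ +-cong (+-congˡ (-‿cong (*-cong u u))) (-‿cong (+-cong (*-cong v v) (-‿cong (*-cong y y)))) ⟩
    x * x - (x - α) * (x - α) - ((x - β) * (x - β) - (x - α - β) * (x - α - β))
      ≈⟨ solve 5 (λ x w₁ w₂ z₁ z₂ →
            let α = w₁ :* (:1 :- :2 :* z₁) ; β = w₂ :* (:1 :- :2 :* z₂) in
            x :* x :- (x :- α) :* (x :- α) :- ((x :- β) :* (x :- β) :- (x :- α :- β) :* (x :- α :- β))
            := w₁ :* (w₂ :* (:- (:2 :* (:2 :* (z₁ :+ z₂ :- :0) :- :1)))) :+ :2 :* :2 :* :2 :* w₁ :* w₂ :* (z₁ :* z₂))
          refl x (W a) (W b) (Z a b) (Z b a) ⟩
    W a * (W b * (- (2# * (2# * (Z a b + Z b a - 0#) - 1#)))) + 2# * 2# * 2# * W a * W b * (Z a b * Z b a)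
      ≈⟨ +-cong (*-congˡ (*-congˡ (-‿cong (*-congˡ (+-congʳ (*-congˡ (+-congˡ (-‿cong (sym (δ-other (a≢b ∘ ≡.sym)))))))))))
                (trans (*-congˡ (Z-antisym a b a≢q b≢q a≢b)) (zeroʳ _)) ⟩
    W a * (W b * (- (2# * H a b))) + 0#
      ≈⟨ +-identityʳ _ ⟩
    W a * (W b * (- (2# * H a b))) ∎
    where
    x = d a b
    α = W a * (1# - 2# * Z a b)
    β = W b * (1# - 2# * Z b a)
    u : d (par a) b ≈ x - α
    u = d-par′ a b a≢q
    v : d a (par b) ≈ x - β
    v = trans (d-sym _ _) (trans (d-par′ b a b≢q) (+-congʳ (d-sym b a)))
    Z-b-par-a : Z b (par a) ≈ Z b a
    Z-b-par-a = sym (trans (Z-par b a b≢q a≢q) (trans (+-congˡ (δ-other a≢b)) (+-identityʳ _)))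
    y : d (par a) (par b) ≈ x - α - β
    y = trans (d-sym _ _) (trans (d-par′ b (par a) b≢q) (+-cong (trans (d-sym _ _) u) (-‿cong (*-congˡ (+-congˡ (-‿cong (*-congˡ Z-b-par-a)))))))

  ν : Fin n → Carrier
  ν = at q 0# (- 1#)

  ν≈0 : ∀ a → ¬ (height (par a) < height a) → ν a ≈ 0#
  ν≈0 a pa≮a with a ≟ q
  ... | yes _  = refl
  ... | no a≢q = contradiction (par-< a a≢q) pa≮a

  -- The convention that `W q` is one lets the same scaling by `W` apply to the row and column of
  -- `q`, which are not differenced.
  det-Δ₀ : det R n Δ₀ ≈ prodFin R n W * (prodFin R n W * det R n M)
  det-Δ₀ = begin
    det R n Δ₀                                       ≈⟨ det-addRows height ν par ν≈0 Δ₀ ⟨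
    det R n Δ₁                                       ≈⟨ det-addColumns height ν par ν≈0 Δ₁ ⟨
    det R n (λ a b → Δ₁ a b + ν b * Δ₁ a (par b))    ≈⟨ det-cong entry ⟩
    det R n (λ a b → W a * (W b * M a b))            ≈⟨ det-scaleRows W (λ a b → W b * M a b) ⟩
    prodFin R n W * det R n (λ a b → W b * M a b)    ≈⟨ *-congˡ (det-scaleColumns W M) ⟩
    prodFin R n W * (prodFin R n W * det R n M)      ∎
    where
    Δ₁ : Matrix n
    Δ₁ a b = Δ₀ a b + ν a * Δ₀ (par a) b
    entry : ∀ a b → Δ₁ a b + ν b * Δ₁ a (par b) ≈ W a * (W b * M a b)
    entry a b with a ≟ q | b ≟ q
    ... | yes ≡.refl | yes ≡.refl = trans (+-congʳ (+-congʳ (*-cong (d-refl q) (d-refl q))))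
      (solve 4 (λ x y w v → :0 :* :0 :+ :0 :* x :+ :0 :* y := w :* (v :* :0)) refl _ _ _ _)
    ... | yes ≡.refl | no b≢q = begin
      Δ₀ q b + 0# * Δ₀ (par q) b + - 1# * (Δ₀ q (par b) + 0# * Δ₀ (par q) (par b))
        ≈⟨ solve 4 (λ a b c d → a :+ :0 :* b :+ :- :1 :* (c :+ :0 :* d) := a :- c) refl _ _ _ _ ⟩
      Δ₀ q b - Δ₀ q (par b)
        ≈⟨ +-cong (*-cong (d-sym _ _) (d-sym _ _)) (-‿cong (*-cong (d-sym _ _) (d-sym _ _))) ⟩
      Δ₀ b q - Δ₀ (par b) q
        ≈⟨ d²-q b b≢q ⟩
      W b * z b
        ≈⟨ trans (sym (*-identityˡ _)) (*-congʳ (sym W-q)) ⟩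
      W q * (W b * z b) ∎
    ... | no a≢q | yes ≡.refl = begin
      Δ₀ a q + - 1# * Δ₀ (par a) q + 0# * (Δ₀ a (par q) + - 1# * Δ₀ (par a) (par q))
        ≈⟨ solve 3 (λ a b c → a :+ :- :1 :* b :+ :0 :* c := a :- b) refl _ _ _ ⟩
      Δ₀ a q - Δ₀ (par a) q
        ≈⟨ d²-q a a≢q ⟩
      W a * z a
        ≈⟨ *-congˡ (trans (sym (*-identityˡ _)) (*-congʳ (sym W-q))) ⟩
      W a * (W q * z a) ∎
    ... | no a≢q | no b≢q = begin
      Δ₀ a b + - 1# * Δ₀ (par a) b + - 1# * (Δ₀ a (par b) + - 1# * Δ₀ (par a) (par b))
        ≈⟨ solve 4 (λ a b c d → a :+ :- :1 :* b :+ :- :1 :* (c :+ :- :1 :* d) := a :- b :- (c :- d)) refl _ _ _ _ ⟩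
      Δ₀ a b - Δ₀ (par a) b - (Δ₀ a (par b) - Δ₀ (par a) (par b))
        ≈⟨ d²-mixed a b a≢q b≢q ⟩
      W a * (W b * (- (2# * H a b))) ∎

  -- core X is X on the vertices other than q and r, extended by an identity block on {q, r}.
  core : Matrix n → Matrix n
  core X a b = at q (δ a b) (at r (δ a b) (at q (δ a b) (at r (δ a b) (X a b) b) b) a) a

  IsCore : Fin n → Set
  IsCore a = a ≢ q × a ≢ r

  core? : ∀ a → (a ≡ q ⊎ a ≡ r) ⊎ IsCore a
  core? a with a ≟ q | a ≟ r
  ... | yes a≡q | _       = inj₁ (inj₁ a≡q)
  ... | no _    | yes a≡r = inj₁ (inj₂ a≡r)
  ... | no a≢q  | no a≢r  = inj₂ (a≢q , a≢r)

  core-in : ∀ X {a b} → IsCore a → IsCore b → core X a b ≈ X a b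
  core-in X {a} {b} (a≢q , a≢r) (b≢q , b≢r) with a ≟ q | a ≟ r | b ≟ q | b ≟ r
  ... | yes a≡q | _ | _ | _ = contradiction a≡q a≢q
  ... | no _ | yes a≡r | _ | _ = contradiction a≡r a≢r
  ... | no _ | no _ | yes b≡q | _ = contradiction b≡q b≢q
  ... | no _ | no _ | no _ | yes b≡r = contradiction b≡r b≢r
  ... | no _ | no _ | no _ | no _ = refl

  core-row : ∀ X {a} b → a ≡ q ⊎ a ≡ r → core X a b ≈ δ a b
  core-row X {a} b a∉ with a ≟ q | a ≟ r
  ... | yes _   | _       = refl
  ... | no _    | yes _   = refl
  ... | no a≢q  | no a≢r  = contradiction a∉ [ a≢q , a≢r ]

  core-column : ∀ X a {b} → b ≡ q ⊎ b ≡ r → core X a b ≈ δ a b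
  core-column X a {b} b∉ with a ≟ q | a ≟ r | b ≟ q | b ≟ r
  ... | yes _ | _ | _ | _ = refl
  ... | no _ | yes _ | _ | _ = refl
  ... | no _ | no _ | yes _ | _ = refl
  ... | no _ | no _ | no _ | yes _ = refl
  ... | no _ | no _ | no b≢q | no b≢r = contradiction b∉ [ b≢q , b≢r ]

  core-off : ∀ X {a b} → IsCore a → b ≡ q ⊎ b ≡ r → core X a b ≈ 0#
  core-off X {a} {b} (a≢q , a≢r) b∉ = trans (core-column X a b∉) (δ-other {a = a} {b} (λ { ≡.refl → [ a≢q , a≢r ] b∉ }))

  onCore : ∀ {i} {A : Set i} → A → A → Fin n → A
  onCore x y a = at q x (at r x y a) a

  onCore-in : ∀ {i} {A : Set i} {x y : A} {a} → IsCore a → onCore x y a ≡ y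
  onCore-in (a≢q , a≢r) = ≡.trans (at-other a≢q) (at-other a≢r)

  onCore-out : ∀ {i} {A : Set i} {x y : A} {a} → a ≡ q ⊎ a ≡ r → onCore x y a ≡ x
  onCore-out (inj₁ ≡.refl) = at-same q
  onCore-out (inj₂ ≡.refl) = ≡.trans (at-other r≢q) (at-same r)

  -- Splitting off the root and `r`

  s : Carrier
  s = W p + W r

  z-child-q : ∀ a → a ≢ q → par a ≡ q → z a ≈ W a
  z-child-q a a≢q pa≡q = begin
    2# * d a q - W a
      ≈⟨ +-congʳ (*-congˡ (trans (d-par a q a≢q) (+-cong (trans (reflexive (≡.cong (λ x → d x q) pa≡q)) (d-refl q)) (*-congˡ (+-congˡ (-‿cong (*-congˡ (Z-root a a≢q)))))))) ⟩
    2# * (0# + W a * (1# - 2# * 0#)) - W a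
      ≈⟨ solve 1 (λ w → :2 :* (:0 :+ w :* (:1 :- :2 :* :0)) :- w := w) refl _ ⟩
    W a ∎

  -- A child of the root has no ancestor but itself among the vertices other than `q`. So its row of
  -- `H` is `2 Z p b - 1` or `2 Z r b - 1`, and the two indicators sum to one.
  H-p+H-r : ∀ b → b ≢ q → H p b + H r b ≈ 0#
  H-p+H-r b b≢q = begin
    H p b + H r b
      ≈⟨ +-cong (H-child p p≢q par-p) (H-child r r≢q par-r) ⟩
    (2# * Z p b - 1#) + (2# * Z r b - 1#)
      ≈⟨ solve 2 (λ x y → (:2 :* x :- :1) :+ (:2 :* y :- :1) := :2 :* (x :+ y) :- :2) refl _ _ ⟩
    2# * (Z p b + Z r b) - 2#
      ≈⟨ +-congʳ (*-congˡ (Z-p+Z-r b (<-wellFounded _) b≢q)) ⟩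
    2# * 1# - 2#
      ≈⟨ solve 0 (:2 :* :1 :- :2 := :0) refl ⟩
    0# ∎
    where
    H-child : ∀ a → a ≢ q → par a ≡ q → H a b ≈ 2# * Z a b - 1#
    H-child a a≢q pa≡q = +-congʳ (*-congˡ (trans (+-congˡ (-‿cong (sym (trans (Z-child-q b a b≢q a≢q pa≡q) (δ-sym b a)))))
      (solve 2 (λ x y → x :+ y :- y := x) refl _ _)))

  M-row : ∀ {b} → b ≢ q → M q b ≈ z b
  M-row b≢q = reflexive (≡.trans (at-same q) (at-other b≢q))

  M-column : ∀ {a} → a ≢ q → M a q ≈ z a
  M-column a≢q = reflexive (≡.trans (at-other a≢q) (at-same q))

  M-in : ∀ {a b} → a ≢ q → b ≢ q → M a b ≈ - (2# * H a b)
  M-in a≢q b≢q = reflexive (≡.trans (at-other a≢q) (at-other b≢q))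

  M-p+M-r : ∀ b → b ≢ q → M r b + 1# * M p b ≈ 0#
  M-p+M-r b b≢q = begin
    M r b + 1# * M p b                                  ≈⟨ +-cong (M-in r≢q b≢q) (*-congˡ (M-in p≢q b≢q)) ⟩
    - (2# * H r b) + 1# * - (2# * H p b)                ≈⟨ solve 2 (λ x y → :- (:2 :* x) :+ :1 :* (:- (:2 :* y)) := :- (:2 :* (y :+ x))) refl _ _ ⟩
    - (2# * (H p b + H r b))                            ≈⟨ -‿cong (*-congˡ (H-p+H-r b b≢q)) ⟩
    - (2# * 0#)                                         ≈⟨ solve 0 (:- (:2 :* :0) := :0) refl ⟩
    0#                                                  ∎

  M-p+M-rᵀ : ∀ a → a ≢ q → M a r + 1# * M a p ≈ 0#
  M-p+M-rᵀ a a≢q = trans (+-cong (M-sym r≢q) (*-congˡ (M-sym p≢q))) (M-p+M-r a a≢q)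
    where
    M-sym : ∀ {b} → b ≢ q → M a b ≈ M b a
    M-sym {b} b≢q = trans (M-in a≢q b≢q) (trans (-‿cong (*-congˡ (H-sym a b))) (sym (M-in b≢q a≢q)))

  -- Three stages of the elimination on the core. The correction by `δ r (par a)` in `F₀` concerns
  -- the children of `r`: the row of their parent is no longer there, and row `p` takes its place.
  Y₀ G₀ F₀ Y G F : Matrix n
  Y₀ a b = - (2# * H a b)
  G₀ a b = 2# * Z b a - 1#
  F₀ a b = at p (2# * δ p b - 1#) (2# * δ a b - 2# * (δ r (par a) * δ p b)) a
  Y = core Y₀
  G = core G₀
  F = core F₀

  -- After both expansions the unit entries of rows `q` and `r` sit at (`q`, `r`) and (`r`, `q`),
  -- whereas `core` has them on the diagonal. Exchanging these rows is the source of the minus sign.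
  det-M : det R n M ≈ s * (s * - det R n Y)
  det-M = begin
    det R n M                    ≈⟨ det-addRows h χ (λ _ → p) χ≈0 M ⟨
    det R n M₁                   ≈⟨ det-addColumns h χ (λ _ → p) χ≈0 M₁ ⟨
    det R n M₂                   ≈⟨ det-unitRow M₂ r q s row-r ⟩
    s * det R n C                ≈⟨ *-congˡ (det-unitColumn C r q s column-r) ⟩
    s * (s * det R n Y₁)         ≈⟨ *-congˡ (*-congˡ (det-swapRows Y₁ Y q≢r Y-q Y-r Y-other)) ⟩
    s * (s * - det R n Y)        ∎
    where
    h : Fin n → ℕ
    h = at p 0 1
    χ : Fin n → Carrier
    χ = at r 1# 0#
    χ-r : χ r ≈ 1#
    χ-r = reflexive (at-same r)
    χ≈0 : ∀ a → ¬ (h p < h a) → χ a ≈ 0#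
    χ≈0 a p≮a with a ≟ r
    ... | no _       = refl
    ... | yes ≡.refl = contradiction (≡.subst₂ _<_ (≡.sym (at-same p)) (≡.sym (at-other (p≢r ∘ ≡.sym))) (s≤s z≤n)) p≮a
    M₁ M₂ C Y₁ : Matrix n
    M₁ a b = M a b + χ a * M p b
    M₂ a b = M₁ a b + χ b * M₁ a p
    C = clear r q M₂
    Y₁ = clear r q (C ᵀ) ᵀ
    row-r : ∀ b → M₂ r b ≈ s * δ q b
    row-r b = by-root (b ≟ q)
      where
      M₁-r : ∀ b → b ≢ q → M₁ r b ≈ 0#
      M₁-r b b≢q = trans (+-congˡ (*-congʳ χ-r)) (M-p+M-r b b≢q)
      by-root : Dec (b ≡ q) → M₂ r b ≈ s * δ q b
      by-root (yes ≡.refl) = begin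
        M₁ r q + χ q * M₁ r p
          ≈⟨ +-cong (+-cong (M-column r≢q) (*-cong χ-r (M-column p≢q))) (*-congʳ (δ-other q≢r)) ⟩
        z r + 1# * z p + 0# * M₁ r p
          ≈⟨ +-congʳ (+-cong (z-child-q r r≢q par-r) (*-congˡ (z-child-q p p≢q par-p))) ⟩
        W r + 1# * W p + 0# * M₁ r p
          ≈⟨ solve 3 (λ x y w → x :+ :1 :* y :+ :0 :* w := (y :+ x) :* :1) refl _ _ _ ⟩
        s * 1#     ≈⟨ *-congˡ (δ-same q) ⟨
        s * δ q q ∎
      by-root (no b≢q) = begin
        M₁ r b + χ b * M₁ r p     ≈⟨ +-cong (M₁-r b b≢q) (*-congˡ (M₁-r p p≢q)) ⟩
        0# + χ b * 0#             ≈⟨ solve 2 (λ x y → :0 :+ x :* :0 := y :* :0) refl _ _ ⟩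
        s * 0#                    ≈⟨ *-congˡ (δ-other b≢q) ⟨
        s * δ q b                 ∎
    M₂-r : ∀ a → M₂ a r ≈ s * δ q a
    M₂-r a = by-root (a ≟ q)
      where
      by-root : Dec (a ≡ q) → M₂ a r ≈ s * δ q a
      by-root (yes ≡.refl) = begin
        M q r + χ q * M p r + χ r * (M q p + χ q * M p p)
          ≈⟨ +-cong (+-cong (M-row r≢q) (*-congʳ (δ-other q≢r))) (*-cong χ-r (+-cong (M-row p≢q) (*-congʳ (δ-other q≢r)))) ⟩
        z r + 0# * M p r + 1# * (z p + 0# * M p p)
          ≈⟨ +-cong (+-congʳ (z-child-q r r≢q par-r)) (*-congˡ (+-congʳ (z-child-q p p≢q par-p))) ⟩
        W r + 0# * M p r + 1# * (W p + 0# * M p p)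
          ≈⟨ solve 4 (λ x y u v → x :+ :0 :* u :+ :1 :* (y :+ :0 :* v) := (y :+ x) :* :1) refl _ _ _ _ ⟩
        s * 1#     ≈⟨ *-congˡ (δ-same q) ⟨
        s * δ q q ∎
      by-root (no a≢q) = begin
        M a r + χ a * M p r + χ r * (M a p + χ a * M p p)
          ≈⟨ +-congˡ (*-congʳ χ-r) ⟩
        M a r + χ a * M p r + 1# * (M a p + χ a * M p p)
          ≈⟨ solve 5 (λ x y u v k → x :+ k :* u :+ :1 :* (y :+ k :* v) := x :+ :1 :* y :+ k :* (u :+ :1 :* v)) refl _ _ _ _ _ ⟩
        M a r + 1# * M a p + χ a * (M p r + 1# * M p p)
          ≈⟨ +-cong (M-p+M-rᵀ a a≢q) (*-congˡ (M-p+M-rᵀ p p≢q)) ⟩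
        0# + χ a * 0#
          ≈⟨ solve 2 (λ x y → :0 :+ x :* :0 := y :* :0) refl _ _ ⟩
        s * 0#     ≈⟨ *-congˡ (δ-other a≢q) ⟨
        s * δ q a ∎
    column-r : ∀ a → C a r ≈ s * δ q a
    column-r a = by-r (a ≟ r)
      where
      by-r : Dec (a ≡ r) → C a r ≈ s * δ q a
      by-r (no a≢r)     = trans (reflexive (≡.trans (at-other a≢r) (at-other r≢q))) (M₂-r a)
      by-r (yes ≡.refl) = trans (reflexive (at-same r)) (trans (δ-other r≢q) (sym (trans (*-congˡ (δ-other r≢q)) (zeroʳ _))))
    Y-q : ∀ b → Y q b ≈ Y₁ r b
    Y-q b with core? b
    ... | inj₁ (inj₁ ≡.refl) = trans (core-row Y₀ q (inj₁ ≡.refl)) (sym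
      (reflexive (≡.trans (at-other q≢r) (≡.trans (at-other r≢q) (at-same r)))))
    ... | inj₁ (inj₂ ≡.refl) = trans (core-row Y₀ r (inj₁ ≡.refl)) (sym (reflexive (at-same r)))
    ... | inj₂ (b≢q , b≢r) = trans (core-row Y₀ b (inj₁ ≡.refl)) (sym
      (reflexive (≡.trans (at-other b≢r) (≡.trans (at-other r≢q) (at-same r)))))
    Y-r : ∀ b → Y r b ≈ Y₁ q b
    Y-r b = by-r (b ≟ r)
      where
      by-r : Dec (b ≡ r) → Y r b ≈ Y₁ q b
      by-r (yes ≡.refl) = trans (core-row Y₀ r (inj₂ ≡.refl)) (trans (δ-same r) (sym (trans (reflexive (at-same r)) (δ-same q))))
      by-r (no b≢r)     = trans (core-row Y₀ b (inj₂ ≡.refl)) (trans (δ-other b≢r) (sym (reflexive (≡.trans (at-other b≢r) (at-same q)))))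
    Y-other : ∀ a → a ≢ q → a ≢ r → ∀ b → Y a b ≈ Y₁ a b
    Y-other a a≢q a≢r b with core? b
    ... | inj₁ (inj₁ ≡.refl) = trans (core-off Y₀ (a≢q , a≢r) (inj₁ ≡.refl)) (sym
      (reflexive (≡.trans (at-other q≢r) (≡.trans (at-other a≢q) (≡.trans (at-other a≢r) (at-same q))))))
    ... | inj₁ (inj₂ ≡.refl) = trans (core-off Y₀ (a≢q , a≢r) (inj₂ ≡.refl)) (sym
      (trans (reflexive (at-same r)) (δ-other a≢q)))
    ... | inj₂ (b≢q , b≢r) = begin
      Y a b            ≈⟨ core-in Y₀ (a≢q , a≢r) (b≢q , b≢r) ⟩
      - (2# * H a b)   ≈⟨ M-in a≢q b≢q ⟨
      M a b            ≈⟨ solve 3 (λ x u v → x := x :+ :0 :* u :+ :0 :* v) refl _ _ _ ⟩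
      M a b + 0# * M p b + 0# * M₁ a p   ≈⟨ +-cong (+-congˡ (*-congʳ (δ-other a≢r))) (*-congʳ (δ-other b≢r)) ⟨
      M₂ a b           ≈⟨ reflexive (≡.trans (at-other b≢r) (≡.trans (at-other a≢q) (≡.trans (at-other a≢r) (at-other b≢q)))) ⟨
      Y₁ a b           ∎

  -- Elimination on the core

  core-child : ∀ {a} b → IsCore a → par b ≡ a → IsCore b
  core-child b (a≢q , _) pb≡a =
    (λ { ≡.refl → a≢q (≡.trans (≡.sym pb≡a) par-q) }) , (λ { ≡.refl → a≢q (≡.trans (≡.sym pb≡a) par-r) })

  rowFactor : Fin n → Carrier
  rowFactor a = onCore 1# (- (2# * t a)) a

  ρ : Fin n → Carrier
  ρ = onCore 0# (- 1#)

  det-Y : det R n Y ≈ prodFin R n rowFactor * det R n G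
  det-Y = begin
    det R n Y                                                  ≈⟨ det-unipotentRows h N N≈0 Y ⟨
    det R n (λ a b → Y a b + sumFin R n (λ x → N a x * Y x b)) ≈⟨ det-cong entry ⟩
    det R n (λ a b → rowFactor a * G a b)                             ≈⟨ det-scaleRows rowFactor G ⟩
    prodFin R n rowFactor * det R n G                                 ∎
    where
    B = proj₁ (maximum height)
    -- Here children are added to parents, so the order by height has to be reversed.
    h : Fin n → ℕ
    h a = B ∸ height a
    N : Matrix n
    N a x = ρ a * δ (par x) a
    N≈0 : ∀ a x → ¬ (h x < h a) → N a x ≈ 0#
    N≈0 a x x≮a with a ≟ par x | core? a
    ... | no _       | _ = zeroʳ _
    ... | yes _      | inj₁ a∉ = trans (*-congʳ (reflexive (onCore-out a∉))) (zeroˡ _)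
    ... | yes ≡.refl | inj₂ a∈ = contradiction (ℕ.∸-monoʳ-< (par-< x (proj₁ (core-child x a∈ ≡.refl))) (proj₂ (maximum height) x)) x≮a
    collapse : ∀ a b → sumFin R n (λ x → N a x * Y x b) ≈ ρ a * sumFin R n (λ x → δ (par x) a * Y x b)
    collapse a b = trans (sum-cong (λ x → *-assoc (ρ a) (δ (par x) a) (Y x b))) (sum-*ˡ {n} (ρ a) _)
    entry : ∀ a b → Y a b + sumFin R n (λ x → N a x * Y x b) ≈ rowFactor a * G a b
    entry a b = trans (+-congˡ (collapse a b)) (by-core (core? a) (core? b))
      where
      by-core : (a ≡ q ⊎ a ≡ r) ⊎ IsCore a → (b ≡ q ⊎ b ≡ r) ⊎ IsCore b →
        Y a b + ρ a * sumFin R n (λ x → δ (par x) a * Y x b) ≈ rowFactor a * G a b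
      by-core (inj₁ a∉) _ = begin
        Y a b + ρ a * sumFin R n (λ x → δ (par x) a * Y x b)  ≈⟨ +-cong (core-row Y₀ b a∉) (*-congʳ (reflexive (onCore-out a∉))) ⟩
        δ a b + 0# * sumFin R n (λ x → δ (par x) a * Y x b)   ≈⟨ solve 2 (λ x y → x :+ :0 :* y := :1 :* x) refl _ _ ⟩
        1# * δ a b                                            ≈⟨ *-cong (reflexive (onCore-out a∉)) (core-row G₀ b a∉) ⟨
        rowFactor a * G a b                                          ∎
      by-core (inj₂ a∈) (inj₁ b∉) = begin
        Y a b + ρ a * sumFin R n (λ x → δ (par x) a * Y x b)  ≈⟨ +-cong (core-off Y₀ a∈ b∉) (*-congˡ (sum-0 no-child)) ⟩
        0# + ρ a * 0#                                         ≈⟨ solve 2 (λ x y → :0 :+ x :* :0 := y :* :0) refl _ _ ⟩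
        rowFactor a * 0#                                             ≈⟨ *-congˡ (core-off G₀ a∈ b∉) ⟨
        rowFactor a * G a b                                          ∎
        where
        no-child : ∀ x → δ (par x) a * Y x b ≈ 0#
        no-child x with a ≟ par x
        ... | no _       = zeroˡ _
        ... | yes a≡px = trans (*-congˡ (core-off Y₀ (core-child x a∈ (≡.sym a≡px)) b∉)) (zeroʳ _)
      by-core (inj₂ a∈) (inj₂ b∈) = begin
        Y a b + ρ a * sumFin R n (λ x → δ (par x) a * Y x b)
          ≈⟨ +-cong (core-in Y₀ a∈ b∈) (*-cong (reflexive (onCore-in a∈)) (trans (sum-cong child) (sum-*ˡ {n} (- 2#) _))) ⟩
        - (2# * H a b) + - 1# * (- 2# * sumFin R n (λ x → δ (par x) a * H x b))
          ≈⟨ +-congˡ (*-congˡ (*-congˡ (Σ-children-H a b (proj₁ a∈) (proj₁ b∈)))) ⟩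
        - (2# * H a b) + - 1# * (- 2# * (H a b - t a * (2# * Z b a - 1#)))
          ≈⟨ solve 3 (λ x k y → :- (:2 :* x) :+ :- :1 :* (:- :2 :* (x :- k :* y)) := :- (:2 :* k) :* y) refl (H a b) (t a) (2# * Z b a - 1#) ⟩
        - (2# * t a) * (2# * Z b a - 1#)
          ≈⟨ *-cong (reflexive (onCore-in a∈)) (core-in G₀ a∈ b∈) ⟨
        rowFactor a * G a b ∎
        where
        child : ∀ x → δ (par x) a * Y x b ≈ - 2# * (δ (par x) a * H x b)
        child x with a ≟ par x
        ... | no _     = solve 2 (λ x y → :0 :* x := :- :2 :* (:0 :* y)) refl _ _
        ... | yes a≡px = trans (*-congˡ (core-in Y₀ (core-child x a∈ (≡.sym a≡px)) b∈)) (solve 1 (λ x → :1 :* (:- (:2 :* x)) := :- :2 :* (:1 :* x)) refl _)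

  p∈ : IsCore p
  p∈ = p≢q , p≢r

  -- Every core vertex but p has a core "foster parent": its parent, or p for the children of r.
  foster : Fin n → Fin n
  foster a = at r p (par a) (par a)

  core-foster : ∀ {a} → IsCore a → a ≢ p → IsCore (foster a)
  core-foster {a} (a≢q , a≢r) a≢p with par a ≟ r
  ... | yes _    = p∈
  ... | no pa≢r  = (λ pa≡q → [ a≢p , a≢r ] (children-q a a≢q pa≡q)) , pa≢r

  -- For a child of `r`, the foster parent `p` is as good as `r` because both are adjacent to the
  -- root and have equal height.
  foster-< : ∀ a → a ≢ q → height (foster a) < height a
  foster-< a a≢q with par a ≟ r | par-< a a≢q
  ... | no _ | pa<a = pa<a
  ... | yes pa≡r | pa<a = ≡.subst (_< height a) (≡.trans (≡.cong height pa≡r) (≡.sym height-pr)) pa<a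

  -- Row `a` of `G` marks the ancestors of `a`, so it differs from the row of its parent only at `a`
  -- itself. For a child of `r` the parent row would be constantly -1 on the core; row `p` is that
  -- up to its entry at `p`, whence one extra entry in column `p`.
  det-G : det R n G ≈ det R n F
  det-G = trans (sym (det-addRows height x foster x≈0 G)) (det-cong entry)
    where
    x : Fin n → Carrier
    x a = at p 0# (ρ a) a
    x≈0 : ∀ a → ¬ (height (foster a) < height a) → x a ≈ 0#
    x≈0 a f≮a with a ≟ p | core? a
    ... | yes _ | _ = refl
    ... | no _  | inj₁ a∉ = reflexive (onCore-out a∉)
    ... | no _  | inj₂ (a≢q , _) = contradiction (foster-< a a≢q) f≮a
    entry-in : ∀ a b → IsCore a → IsCore b → a ≢ p →
      (2# * Z b a - 1#) + - 1# * (2# * Z b (foster a) - 1#) ≈ 2# * δ a b - 2# * (δ r (par a) * δ p b)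
    entry-in a b (a≢q , _) (b≢q , b≢r) a≢p with par a ≟ r in pa
    ... | yes pa≡r = begin
      (2# * Z b a - 1#) + - 1# * (2# * Z b p - 1#)
        ≈⟨ +-cong (+-congʳ (*-congˡ Zba)) (*-congˡ (+-congʳ (*-congˡ (trans (Z-child-q b p b≢q p≢q par-p) (δ-sym b p))))) ⟩
      (2# * δ a b - 1#) + - 1# * (2# * δ p b - 1#)
        ≈⟨ solve 2 (λ x y → (:2 :* x :- :1) :+ :- :1 :* (:2 :* y :- :1) := :2 :* x :- :2 :* (:1 :* y)) refl _ _ ⟩
      2# * δ a b - 2# * (1# * δ p b) ∎
      where
      Zba : Z b a ≈ δ a b
      Zba = begin
        Z b a                ≈⟨ Z-par b a b≢q a≢q ⟩
        Z b (par a) + δ b a  ≈⟨ +-cong (trans (reflexive (≡.cong (Z b) pa≡r)) (trans (Z-child-q b r b≢q r≢q par-r) (δ-other (b≢r ∘ ≡.sym)))) (δ-sym b a) ⟩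
        0# + δ a b           ≈⟨ +-identityˡ _ ⟩
        δ a b                ∎
    ... | no _ = begin
      (2# * Z b a - 1#) + - 1# * (2# * Z b (par a) - 1#)
        ≈⟨ +-congʳ (+-congʳ (*-congˡ (trans (Z-par b a b≢q a≢q) (+-congˡ (δ-sym b a))))) ⟩
      (2# * (Z b (par a) + δ a b) - 1#) + - 1# * (2# * Z b (par a) - 1#)
        ≈⟨ solve 3 (λ x e y → (:2 :* (x :+ e) :- :1) :+ :- :1 :* (:2 :* x :- :1) := :2 :* e :- :2 :* (:0 :* y)) refl _ _ _ ⟩
      2# * δ a b - 2# * (0# * δ p b) ∎
    entry : ∀ a b → G a b + x a * G (foster a) b ≈ F a b
    entry a b = by-core (core? a) (core? b) (a ≟ p)
      where
      by-core : (a ≡ q ⊎ a ≡ r) ⊎ IsCore a → (b ≡ q ⊎ b ≡ r) ⊎ IsCore b → Dec (a ≡ p) → G a b + x a * G (foster a) b ≈ F a b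
      by-core (inj₁ a∉) _ _ = begin
        G a b + x a * G (foster a) b    ≈⟨ +-cong (core-row G₀ b a∉) (*-congʳ x-out) ⟩
        δ a b + 0# * G (foster a) b     ≈⟨ solve 2 (λ x y → x :+ :0 :* y := x) refl _ _ ⟩
        δ a b                           ≈⟨ core-row F₀ b a∉ ⟨
        F a b                           ∎
        where
        x-out : x a ≈ 0#
        x-out with a ≟ p
        ... | yes _ = refl
        ... | no _  = reflexive (onCore-out a∉)
      by-core (inj₂ a∈) b∈? (yes ≡.refl) = trans (+-congˡ (*-congʳ (reflexive (at-same p))))
        (trans (solve 2 (λ x y → x :+ :0 :* y := x) refl _ _) (row-p b∈?))
        where
        row-p : (b ≡ q ⊎ b ≡ r) ⊎ IsCore b → G p b ≈ F p b
        row-p (inj₁ b∉) = trans (core-off G₀ p∈ b∉) (sym (core-off F₀ p∈ b∉))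
        row-p (inj₂ b∈) = begin
          G p b              ≈⟨ core-in G₀ p∈ b∈ ⟩
          2# * Z b p - 1#    ≈⟨ +-congʳ (*-congˡ (trans (Z-child-q b p (proj₁ b∈) p≢q par-p) (δ-sym b p))) ⟩
          2# * δ p b - 1#    ≈⟨ reflexive (at-same p) ⟨
          F₀ p b             ≈⟨ core-in F₀ p∈ b∈ ⟨
          F p b              ∎
      by-core (inj₂ a∈) b∈? (no a≢p) = trans (+-congˡ (*-congʳ (reflexive (≡.trans (at-other a≢p) (onCore-in a∈))))) (row-a b∈?)
        where
        row-a : (b ≡ q ⊎ b ≡ r) ⊎ IsCore b → G a b + - 1# * G (foster a) b ≈ F a b
        row-a (inj₁ b∉) = begin
          G a b + - 1# * G (foster a) b    ≈⟨ +-cong (core-off G₀ a∈ b∉) (*-congˡ (core-off G₀ (core-foster a∈ a≢p) b∉)) ⟩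
          0# + - 1# * 0#                   ≈⟨ solve 0 (:0 :+ :- :1 :* :0 := :0) refl ⟩
          0#                               ≈⟨ core-off F₀ a∈ b∉ ⟨
          F a b                            ∎
        row-a (inj₂ b∈) = begin
          G a b + - 1# * G (foster a) b
            ≈⟨ +-cong (core-in G₀ a∈ b∈) (*-congˡ (core-in G₀ (core-foster a∈ a≢p) b∈)) ⟩
          (2# * Z b a - 1#) + - 1# * (2# * Z b (foster a) - 1#)
            ≈⟨ entry-in a b a∈ b∈ a≢p ⟩
          2# * δ a b - 2# * (δ r (par a) * δ p b)
            ≈⟨ reflexive (at-other a≢p) ⟨
          F₀ a b
            ≈⟨ core-in F₀ a∈ b∈ ⟨
          F a b ∎

  y : Fin n → Carrier
  y a = onCore 1# (at p 1# 2# a) a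

  -- On the core, `F` is diagonal except for entries -1 along row `p` and -2 in column `p` at the
  -- children of `r`. Adding the columns of those children to column `p` cancels each -2 against a
  -- diagonal 2 and lowers the entry at `p` by one per child, from 1 to `t r`. The unit column then
  -- clears row `p`.
  det-F : det R n F ≈ t r * prodFin R n y
  det-F = begin
    det R n F                  ≈⟨ det-unipotentColumns h N N≈0 F ⟨
    det R n E                  ≈⟨ det-unitColumn E p p (t r) column-p ⟩
    t r * det R n D            ≈⟨ *-congˡ (det-diagonal y D diagonal) ⟩
    t r * prodFin R n y        ∎
    where
    h : Fin n → ℕ
    h = at p 1 0
    χ : Fin n → Carrier
    χ x = δ r (par x)
    χ-child-q : ∀ {a} → par a ≡ q → χ a ≈ 0#
    χ-child-q pa≡q = δ-other (λ pa≡r → q≢r (≡.trans (≡.sym pa≡q) pa≡r))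
    χ-core : ∀ x → ¬ IsCore x → χ x ≈ 0#
    χ-core x x∉ with core? x
    ... | inj₁ (inj₁ ≡.refl) = χ-child-q par-q
    ... | inj₁ (inj₂ ≡.refl) = χ-child-q par-r
    ... | inj₂ x∈            = contradiction x∈ x∉
    N E D : Matrix n
    N b x = δ p b * χ x
    N≈0 : ∀ b x → ¬ (h x < h b) → N b x ≈ 0#
    N≈0 b x x≮b with b ≟ p | x ≟ p
    ... | no _  | _          = zeroˡ _
    ... | yes _ | yes ≡.refl = trans (*-congˡ (χ-child-q par-p)) (zeroʳ _)
    ... | yes _ | no _       = contradiction (s≤s z≤n) x≮b
    E a b = F a b + sumFin R n (λ x → N b x * F a x)
    D = clear p p (E ᵀ) ᵀ
    E-collapse : ∀ a b → E a b ≈ F a b + δ p b * sumFin R n (λ x → χ x * F a x)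
    E-collapse a b = +-congˡ (trans (sum-cong (λ x → *-assoc (δ p b) (χ x) (F a x))) (sum-*ˡ {n} (δ p b) _))
    E-p : ∀ a → E a p ≈ F a p + sumFin R n (λ x → χ x * F a x)
    E-p a = trans (E-collapse a p) (+-congˡ (trans (*-congʳ (δ-same p)) (*-identityˡ _)))
    F-in : ∀ {a b} → IsCore a → IsCore b → a ≢ p → F a b ≈ 2# * δ a b - 2# * (χ a * δ p b)
    F-in a∈ b∈ a≢p = trans (core-in F₀ a∈ b∈) (reflexive (at-other a≢p))
    F-p : ∀ {b} → IsCore b → F p b ≈ 2# * δ p b - 1#
    F-p b∈ = trans (core-in F₀ p∈ b∈) (reflexive (at-same p))
    column-p : ∀ a → E a p ≈ t r * δ p a
    column-p a = trans (E-p a) (by-core (core? a) (a ≟ p))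
      where
      by-core : (a ≡ q ⊎ a ≡ r) ⊎ IsCore a → Dec (a ≡ p) → F a p + sumFin R n (λ x → χ x * F a x) ≈ t r * δ p a
      by-core (inj₁ a∉) _ = begin
        F a p + sumFin R n (λ x → χ x * F a x)    ≈⟨ +-cong (trans (core-row F₀ p a∉) (trans (δ-sym a p) (δ-other a≢p))) (sum-0 zero-term) ⟩
        0# + 0#                                   ≈⟨ solve 1 (λ x → :0 :+ :0 := x :* :0) refl _ ⟩
        t r * 0#                                  ≈⟨ *-congˡ (δ-other a≢p) ⟨
        t r * δ p a                               ∎
        where
        a≢p : a ≢ p
        a≢p ≡.refl = [ p≢q , p≢r ] a∉
        zero-term : ∀ x → χ x * F a x ≈ 0#
        zero-term x with core? x
        ... | inj₁ x∉          = trans (*-congʳ (χ-core x (λ { (x≢q , x≢r) → [ x≢q , x≢r ] x∉ }))) (zeroˡ _)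
        ... | inj₂ (x≢q , x≢r) = trans (*-congˡ (trans (core-row F₀ x a∉) (δ-other {a = a} {x} (λ { ≡.refl → [ x≢q , x≢r ] a∉ })))) (zeroʳ _)
      by-core (inj₂ a∈) (yes ≡.refl) = begin
        F p p + sumFin R n (λ x → χ x * F p x)
          ≈⟨ +-cong (trans (F-p p∈) (+-congʳ (*-congˡ (δ-same p)))) (trans (sum-cong summand) (sum-*ˡ {n} (- 1#) _)) ⟩
        (2# * 1# - 1#) + - 1# * ch r
          ≈⟨ solve 1 (λ k → (:2 :* :1 :- :1) :+ :- :1 :* k := (:1 :- k) :* :1) refl _ ⟩
        t r * 1#
          ≈⟨ *-congˡ (δ-same p) ⟨
        t r * δ p p ∎
        where
        summand : ∀ x → χ x * F p x ≈ - 1# * δ (par x) r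
        summand x = by-core′ (core? x) (x ≟ p)
          where
          vanish : χ x ≈ 0# → χ x * F p x ≈ - 1# * δ (par x) r
          vanish χx = trans (*-congʳ χx) (trans (solve 1 (λ y → :0 :* y := :- :1 :* :0) refl _) (*-congˡ (trans (sym χx) (δ-sym r (par x)))))
          by-core′ : (x ≡ q ⊎ x ≡ r) ⊎ IsCore x → Dec (x ≡ p) → χ x * F p x ≈ - 1# * δ (par x) r
          by-core′ (inj₁ x∉) _ = vanish (χ-core x (λ { (x≢q , x≢r) → [ x≢q , x≢r ] x∉ }))
          by-core′ (inj₂ x∈) (yes ≡.refl) = vanish (χ-child-q par-p)
          by-core′ (inj₂ x∈) (no x≢p) = begin
            χ x * F p x                  ≈⟨ *-cong (δ-sym r (par x)) (trans (F-p x∈) (+-congʳ (*-congˡ (δ-other x≢p)))) ⟩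
            δ (par x) r * (2# * 0# - 1#) ≈⟨ solve 1 (λ k → k :* (:2 :* :0 :- :1) := :- :1 :* k) refl _ ⟩
            - 1# * δ (par x) r           ∎
      by-core (inj₂ a∈) (no a≢p) = begin
        F a p + sumFin R n (λ x → χ x * F a x)
          ≈⟨ +-cong (trans (F-in a∈ p∈ a≢p) (+-cong (*-congˡ (trans (δ-sym a p) (δ-other a≢p))) (-‿cong (*-congˡ (*-congˡ (δ-same p))))))
                    (trans (sum-cong summand) (sum-δ a (λ x → 2# * χ x))) ⟩
        (2# * 0# - 2# * (χ a * 1#)) + 2# * χ a
          ≈⟨ solve 2 (λ k x → (:2 :* :0 :- :2 :* (k :* :1)) :+ :2 :* k := x :* :0) refl _ _ ⟩
        t r * 0#
          ≈⟨ *-congˡ (δ-other a≢p) ⟨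
        t r * δ p a ∎
        where
        summand : ∀ x → χ x * F a x ≈ δ a x * (2# * χ x)
        summand x = by-core′ (core? x) (x ≟ p)
          where
          vanish : χ x ≈ 0# → χ x * F a x ≈ δ a x * (2# * χ x)
          vanish χx = trans (*-congʳ χx) (trans (solve 2 (λ y e → :0 :* y := e :* (:2 :* :0)) refl _ _) (*-congˡ (*-congˡ (sym χx))))
          by-core′ : (x ≡ q ⊎ x ≡ r) ⊎ IsCore x → Dec (x ≡ p) → χ x * F a x ≈ δ a x * (2# * χ x)
          by-core′ (inj₁ x∉) _ = vanish (χ-core x (λ { (x≢q , x≢r) → [ x≢q , x≢r ] x∉ }))
          by-core′ (inj₂ x∈) (yes ≡.refl) = vanish (χ-child-q par-p)
          by-core′ (inj₂ x∈) (no x≢p) = begin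
            χ x * F a x
              ≈⟨ *-congˡ (trans (F-in a∈ x∈ a≢p) (+-congˡ (-‿cong (*-congˡ (*-congˡ (δ-other x≢p)))))) ⟩
            χ x * (2# * δ a x - 2# * (χ a * 0#))
              ≈⟨ solve 3 (λ k e j → k :* (:2 :* e :- :2 :* (j :* :0)) := e :* (:2 :* k)) refl _ _ _ ⟩
            δ a x * (2# * χ x) ∎
    E-other : ∀ a b → b ≢ p → E a b ≈ F a b
    E-other a b b≢p = trans (E-collapse a b) (trans (+-congˡ (trans (*-congʳ (δ-other b≢p)) (zeroˡ _))) (+-identityʳ _))
    D-entry : ∀ a b → a ≢ p → b ≢ p → D a b ≈ F a b
    D-entry a b a≢p b≢p = trans (reflexive (≡.trans (at-other b≢p) (at-other a≢p))) (E-other a b b≢p)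
    diagonal : ∀ a b → D a b ≈ y a * δ a b
    diagonal a b = by-p (a ≟ p) (b ≟ p)
      where
      y-p : y p ≈ 1#
      y-p = reflexive (≡.trans (onCore-in p∈) (at-same p))
      by-p : Dec (a ≡ p) → Dec (b ≡ p) → D a b ≈ y a * δ a b
      by-p (yes ≡.refl) (yes ≡.refl) = trans (reflexive (at-same p)) (sym (trans (*-congʳ y-p) (*-identityˡ _)))
      by-p (no a≢p) (yes ≡.refl) = trans (reflexive (at-same p)) (trans (δ-other a≢p) (sym (trans (*-congˡ (δ-other (a≢p ∘ ≡.sym))) (zeroʳ _))))
      by-p (yes ≡.refl) (no b≢p) = trans (reflexive (≡.trans (at-other b≢p) (at-same p))) (sym (trans (*-congˡ (δ-other b≢p)) (zeroʳ _)))
      by-p (no a≢p) (no b≢p) = trans (D-entry a b a≢p b≢p) (by-core (core? a) (core? b))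
        where
        by-core : (a ≡ q ⊎ a ≡ r) ⊎ IsCore a → (b ≡ q ⊎ b ≡ r) ⊎ IsCore b → F a b ≈ y a * δ a b
        by-core (inj₁ a∉) _ = trans (core-row F₀ b a∉) (sym (trans (*-congʳ (reflexive (onCore-out a∉))) (*-identityˡ _)))
        by-core (inj₂ a∈) (inj₁ b∉) = trans (core-off F₀ a∈ b∉) (sym (trans (*-congˡ (trans (sym (core-column F₀ a b∉)) (core-off F₀ a∈ b∉))) (zeroʳ _)))
        by-core (inj₂ a∈) (inj₂ b∈) = begin
          F a b                                   ≈⟨ F-in a∈ b∈ a≢p ⟩
          2# * δ a b - 2# * (χ a * δ p b)         ≈⟨ +-congˡ (-‿cong (*-congˡ (*-congˡ (δ-other b≢p)))) ⟩
          2# * δ a b - 2# * (χ a * 0#)            ≈⟨ solve 2 (λ e k → :2 :* e :- :2 :* (k :* :0) := :2 :* e) refl _ _ ⟩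
          2# * δ a b                              ≈⟨ *-congʳ (reflexive (≡.trans (onCore-in a∈) (at-other a≢p))) ⟨
          y a * δ a b                             ∎

  det-squaredDistances : det R n (λ a b → d a b * d a b) ≈
    prodFin R n W * (prodFin R n W * (s * (s * - (prodFin R n rowFactor * (t r * prodFin R n y)))))
  det-squaredDistances = trans det-Δ₀ (*-congˡ (*-congˡ (trans det-M (*-congˡ (*-congˡ (-‿cong
    (trans det-Y (*-congˡ (trans det-G det-F)))))))))

-- Paths in a tree

module TreePaths {n m : ℕ} (e : Edges n m) (T : IsTree e) where
  open IsTree T
  open Data.List.Membership.DecPropositional (_≟_ {n}) using (_∈?_)

  E : Fin n → Fin n → List (Fin m)
  E a b = edgesOf e (Path.walk (thePath a b))

  E-unique : ∀ {a b} (W : Walk e a b) → Unique (verticesOf e W) → edgesOf e W ≡ E a b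
  E-unique {a} {b} W uniq = pathUnique a b (path W uniq) (thePath a b)

  edge-≢ : ∀ {s a c} → EdgeIs e s a c → a ≢ c
  edge-≢ {s} (inj₁ eq) ≡.refl = loopless s (≡.trans (≡.cong proj₁ eq) (≡.sym (≡.cong proj₂ eq)))
  edge-≢ {s} (inj₂ eq) ≡.refl = loopless s (≡.trans (≡.cong proj₁ eq) (≡.sym (≡.cong proj₂ eq)))

  edge-end : ∀ {s a c d} → EdgeIs e s a c → EdgeIs e s a d → c ≡ d
  edge-end (inj₁ eq) (inj₁ eq′) = ≡.cong proj₂ (≡.trans (≡.sym eq) eq′)
  edge-end (inj₂ eq) (inj₂ eq′) = ≡.cong proj₁ (≡.trans (≡.sym eq) eq′)
  edge-end (inj₁ eq) (inj₂ eq′) with ≡.trans (≡.sym eq) eq′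
  ... | ≡.refl = ≡.refl
  edge-end (inj₂ eq) (inj₁ eq′) with ≡.trans (≡.sym eq) eq′
  ... | ≡.refl = ≡.refl

  start∈ : ∀ {a b} (W : Walk e a b) → a ∈ verticesOf e W
  start∈ done         = here ≡.refl
  start∈ (step _ _ W) = here ≡.refl

  -- `before-⊆` speaks of avoiding a vertex, the form in which `Unique` asks for it when a step is
  -- put in front of the initial segment.
  record Split {a b} (W : Walk e a b) (x : Fin n) : Set where
    field
      before    : Walk e a x
      after     : Walk e x b
      edges-++  : edgesOf e W ≡ edgesOf e before ++ edgesOf e after
      before-⊆  : ∀ {y} → All (y ≢_) (verticesOf e W) → All (y ≢_) (verticesOf e before)
      before-un : Unique (verticesOf e before)
      after-un  : Unique (verticesOf e after)

  split : ∀ {a b x} (W : Walk e a b) → Unique (verticesOf e W) → x ∈ verticesOf e W → Split W x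
  split done uniq (here ≡.refl) = record
    { before = done ; after = done ; edges-++ = ≡.refl ; before-⊆ = λ p → p ; before-un = uniq ; after-un = uniq }
  split (step i eq W) uniq (here ≡.refl) = record
    { before = done ; after = step i eq W ; edges-++ = ≡.refl ; before-⊆ = λ { (p ∷ _) → p ∷ [] } ; before-un = [] ∷ [] ; after-un = uniq }
  split (step i eq W) (a∉ ∷ uniq) (there x∈) = record
    { before = step i eq before ; after = after ; edges-++ = ≡.cong (i ∷_) edges-++
    ; before-⊆ = λ { (p ∷ ps) → p ∷ before-⊆ ps } ; before-un = before-⊆ a∉ ∷ before-un ; after-un = after-un }
    where open Split (split W uniq x∈)

  -- If the path from `y` to `b` misses `x`, the edge can be put in front of it. If it meets `x`,
  -- its initial segment is a path from `y` to `x`, which by uniqueness consists of the edge `s`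
  -- alone.
  E-step : ∀ {s x y} b → EdgeIs e s x y → E x b ≡ s ∷ E y b ⊎ E y b ≡ s ∷ E x b
  E-step {s} {x} {y} b eq with thePath y b in Pyb
  ... | path W uniq with x ∈? verticesOf e W
  ... | no x∉ = inj₁ (≡.sym (E-unique (step s eq W) (¬Any⇒All¬ _ x∉ ∷ uniq)))
  ... | yes x∈ = inj₂ (≡.trans edges-++ (≡.cong₂ _++_ before≡ (E-unique after after-un)))
    where
    open Split (split W uniq x∈)
    before≡ : edgesOf e before ≡ s ∷ []
    before≡ = ≡.trans (E-unique before before-un)
      (≡.sym (E-unique (step s (⊎.swap eq) done) (((edge-≢ eq ∘ ≡.sym) ∷ []) ∷ [] ∷ [])))

  -- Using one edge twice in a row leads back to the starting vertex, which a path cannot revisit.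
  -- This is the contradiction behind all later comparisons of paths.
  no-backtrack : ∀ {x b s L} (W : Walk e x b) → Unique (verticesOf e W) → edgesOf e W ≢ s ∷ s ∷ L
  no-backtrack (step i eq (step j eq′ W)) (x∉ ∷ _) edges≡ with List.∷-injective edges≡
  ... | ≡.refl , edges≡′ with List.∷-injectiveˡ edges≡′
  ... | ≡.refl with edge-end (⊎.swap eq) eq′
  ... | ≡.refl = excluded x∉ (there (start∈ W))
    where
    excluded : ∀ {x} {L : List (Fin n)} → All (x ≢_) L → x ∉ L
    excluded (x≢ ∷ _)  (here x≡)  = x≢ x≡
    excluded (_ ∷ x∉L) (there x∈) = excluded x∉L x∈

  E-no-backtrack : ∀ {x b s L} → E x b ≢ s ∷ s ∷ L
  E-no-backtrack {x} {b} = no-backtrack (Path.walk (thePath x b)) (Path.distinct (thePath x b))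

  E-refl : ∀ a → E a a ≡ []
  E-refl a = ≡.sym (E-unique done ([] ∷ []))

  no-edges : ∀ {a b} (W : Walk e a b) → edgesOf e W ≡ [] → a ≡ b
  no-edges done _ = ≡.refl

  E-[] : ∀ {a b} → E a b ≡ [] → a ≡ b
  E-[] {a} {b} = no-edges (Path.walk (thePath a b))

  snoc : ∀ {a b c} {i} → Walk e a b → EdgeIs e i b c → Walk e a c
  snoc {i = i} done eq = step i eq done
  snoc (step j eq′ W) eq = step j eq′ (snoc W eq)

  edgesOf-snoc : ∀ {a b c i} (W : Walk e a b) (eq : EdgeIs e i b c) → edgesOf e (snoc W eq) ≡ edgesOf e W ∷ʳ i
  edgesOf-snoc done           eq = ≡.refl
  edgesOf-snoc (step j eq′ W) eq = ≡.cong (j ∷_) (edgesOf-snoc W eq)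

  verticesOf-snoc : ∀ {a b c i} (W : Walk e a b) (eq : EdgeIs e i b c) → verticesOf e (snoc W eq) ≡ verticesOf e W ∷ʳ c
  verticesOf-snoc done               eq = ≡.refl
  verticesOf-snoc {a} (step j eq′ W) eq = ≡.cong (a ∷_) (verticesOf-snoc W eq)

  reverseʷ : ∀ {a b} → Walk e a b → Walk e b a
  reverseʷ done          = done
  reverseʷ (step i eq W) = snoc (reverseʷ W) (⊎.swap eq)

  edgesOf-reverse : ∀ {a b} (W : Walk e a b) → edgesOf e (reverseʷ W) ≡ reverse (edgesOf e W)
  edgesOf-reverse done = ≡.refl
  edgesOf-reverse (step i eq W) = ≡.trans (edgesOf-snoc (reverseʷ W) (⊎.swap eq))
    (≡.trans (≡.cong (_∷ʳ i) (edgesOf-reverse W)) (≡.sym (List.unfold-reverse i (edgesOf e W))))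

  verticesOf-reverse : ∀ {a b} (W : Walk e a b) → verticesOf e (reverseʷ W) ≡ reverse (verticesOf e W)
  verticesOf-reverse done = ≡.refl
  verticesOf-reverse {a} (step i eq W) = ≡.trans (verticesOf-snoc (reverseʷ W) (⊎.swap eq))
    (≡.trans (≡.cong (_∷ʳ a) (verticesOf-reverse W)) (≡.sym (List.unfold-reverse a (verticesOf e W))))

  E-reverse : ∀ a b → E b a ≡ reverse (E a b)
  E-reverse a b = ≡.trans (≡.sym (E-unique (reverseʷ walk) unique)) (edgesOf-reverse walk)
    where
    open Path (thePath a b)
    unique : Unique (verticesOf e (reverseʷ walk))
    unique = ≡.subst Unique (≡.sym (verticesOf-reverse walk))
      (Permutation.Unique-resp-↭ (≡.setoid (Fin n)) (↭⇒↭ₛ (↭-sym (↭-reverse (verticesOf e walk)))) distinct)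

  E-step′ : ∀ {s x y} a → EdgeIs e s x y → E a x ≡ E a y ∷ʳ s ⊎ E a y ≡ E a x ∷ʳ s
  E-step′ {s} {x} {y} a eq = ⊎.map (last-edge x y) (last-edge y x) (E-step a eq)
    where
    last-edge : ∀ x y → E x a ≡ s ∷ E y a → E a x ≡ E a y ∷ʳ s
    last-edge x y eq = ≡.trans (E-reverse x a) (≡.trans (≡.cong reverse eq)
      (≡.trans (List.unfold-reverse s (E y a)) (≡.cong (_∷ʳ s) (≡.sym (E-reverse y a)))))

-- Orientation of the tree towards a root

module Rooted {n m : ℕ} (e : Edges n m) (T : IsTree e) (q : Fin n) where
  open IsTree T
  open TreePaths e T

  nextVertex : ∀ {a b} → Walk e a b → Fin n
  nextVertex {a} done             = a
  nextVertex (step {c = c} _ _ _) = c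

  par : Fin n → Fin n
  par a = nextVertex (Path.walk (thePath a q))

  height : Fin n → ℕ
  height a = length (E a q)

  par-q : par q ≡ q
  par-q = stay _ (E-refl q)
    where
    stay : ∀ {a b} (W : Walk e a b) → edgesOf e W ≡ [] → nextVertex W ≡ a
    stay done _ = ≡.refl

  record ParentEdge (a : Fin n) : Set where
    field
      edge   : Fin m
      joins  : EdgeIs e edge a (par a)
      E-root : E a q ≡ edge ∷ E (par a) q

  parentEdge : ∀ a → a ≢ q → ParentEdge a
  parentEdge a a≢q = first (Path.walk (thePath a q)) ≡.refl ≡.refl
    where
    first : (W : Walk e a q) → nextVertex W ≡ par a → edgesOf e W ≡ E a q → ParentEdge a
    first done _ _ = contradiction ≡.refl a≢q
    first (step s eq W) ≡.refl E≡ with E-step q eq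
    ... | inj₁ up   = record { edge = s ; joins = eq ; E-root = up }
    -- The walk at hand shows that `E a q` itself begins with `s`, so this alternative would use `s`
    -- twice in a row.
    ... | inj₂ down = contradiction (≡.trans down (≡.cong (s ∷_) (≡.sym E≡))) E-no-backtrack

  parentEdge-unique : ∀ {s a c} → EdgeIs e s a c → E a q ≡ s ∷ E c q → par a ≡ c
  parentEdge-unique {s} {a} {c} eq E≡ = edge-end (≡.subst (λ s → EdgeIs e s a (par a)) edge≡ joins) eq
    where
    a≢q : a ≢ q
    a≢q ≡.refl with ≡.trans (≡.sym (E-refl q)) E≡
    ... | ()
    open ParentEdge (parentEdge a a≢q)
    edge≡ : edge ≡ s
    edge≡ = List.∷-injectiveˡ (≡.trans (≡.sym E-root) E≡)

  par-< : ∀ a → a ≢ q → height (par a) < height a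
  par-< a a≢q = ≡.subst (height (par a) <_) (≡.sym (≡.cong length E-root)) (ℕ.n<1+n _)
    where open ParentEdge (parentEdge a a≢q)

  E-child-q : ∀ {s a} → EdgeIs e s a q → E a q ≡ s ∷ []
  E-child-q {s} eq with E-step q eq
  ... | inj₁ up = ≡.trans up (≡.cong (s ∷_) (E-refl q))
  ... | inj₂ down with ≡.trans (≡.sym (E-refl q)) down
  ... | ()

  par-child-q : ∀ {s a} → EdgeIs e s a q → par a ≡ q
  par-child-q {s} eq = parentEdge-unique eq (≡.trans (E-child-q eq) (≡.cong (s ∷_) (≡.sym (E-refl q))))

  -- For `a` other than the root, `Toward a b` means that `b` lies in the subtree of `a`, and
  -- `Away a b` that it does not. Keeping the edge as data allows the edge lists to be compared at
  -- their heads.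
  Away Toward : Fin n → Fin n → Set
  Away   a b = Σ[ s ∈ Fin m ] (EdgeIs e s a (par a) × E a b ≡ s ∷ E (par a) b)
  Toward a b = Σ[ s ∈ Fin m ] (EdgeIs e s a (par a) × E (par a) b ≡ s ∷ E a b)

  direction : ∀ a b → a ≢ q → Away a b ⊎ Toward a b
  direction a b a≢q = ⊎.map (λ E≡ → edge , joins , E≡) (λ E≡ → edge , joins , E≡) (E-step b joins)
    where open ParentEdge (parentEdge a a≢q)

  same-edge : ∀ {a s s′} → EdgeIs e s a (par a) → EdgeIs e s′ a (par a) → s ≡ s′
  same-edge {a} {s} {s′} eq eq′ = List.∷-injectiveˡ (≡.trans (single eq) (≡.sym (single eq′)))
    where
    single : ∀ {s} → EdgeIs e s a (par a) → s ∷ [] ≡ E a (par a)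
    single {s} eq = E-unique (step s eq done) ((edge-≢ eq ∷ []) ∷ [] ∷ [])

  nonempty : ∀ {a b} → a ≢ b → ∃ λ s → ∃ λ L → E a b ≡ s ∷ L
  nonempty {a} {b} a≢b with E a b in E≡
  ... | []    = contradiction (E-[] E≡) a≢b
  ... | s ∷ L = s , L , ≡.refl

  -- Four-cycle argument on a, par a, b, par b: the alternative would force a backtrack.
  away-par : ∀ a b → a ≢ q → b ≢ q → a ≢ b → Away a b → Away a (par b)
  away-par a b a≢q b≢q a≢b (s , eq , away) with direction a (par b) a≢q
  ... | inj₁ away′ = away′
  ... | inj₂ (s′ , eq′ , toward′) with same-edge eq eq′
  ... | ≡.refl with E-step′ a (ParentEdge.joins (parentEdge b b≢q))
  ... | inj₂ E≡ = contradiction (≡.trans toward′ (≡.cong (s ∷_) (≡.trans E≡ (≡.cong (_∷ʳ _) away)))) E-no-backtrack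
  ... | inj₁ E≡ with a ≟ par b
  ... | no a≢pb with nonempty a≢pb
  ... | t , L , E≡′ with List.∷-injectiveˡ (≡.trans (≡.sym away) (≡.trans E≡ (≡.cong (_∷ʳ _) E≡′)))
  ... | ≡.refl = contradiction (≡.trans toward′ (≡.cong (s ∷_) E≡′)) E-no-backtrack
  -- The degenerate case: with `a` the parent of `b`, the path from `a` to `b` is one edge, so
  -- `par a` would be `b`, and two vertices cannot each be the parent of the other.
  away-par a b a≢q b≢q a≢b (s , eq , away) | inj₂ (s′ , eq′ , toward′) | ≡.refl | inj₁ E≡ | yes ≡.refl =
    contradiction (ℕ.<-trans (par-< a a≢q) (par-< b b≢q)) (ℕ.<-irrefl (≡.cong height pa≡b))
    where
    pa≡b : par a ≡ b
    pa≡b = E-[] (List.∷-injectiveʳ (≡.trans (≡.sym away) (≡.trans E≡ (≡.cong (_∷ʳ ParentEdge.edge (parentEdge b b≢q)) (E-refl a)))))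

  -- The same comparison of four paths as in `away-par`. No degenerate case arises, because the list
  -- whose head is inspected is `E a b`, nonempty by `a ≢ b`.
  toward-par : ∀ a b → a ≢ q → b ≢ q → a ≢ b → Toward a b → Toward a (par b)
  toward-par a b a≢q b≢q a≢b (s , eq , toward) with direction a (par b) a≢q
  ... | inj₂ toward′ = toward′
  ... | inj₁ (s′ , eq′ , away′) with same-edge eq eq′
  ... | ≡.refl with E-step′ a (ParentEdge.joins (parentEdge b b≢q))
  ... | inj₁ E≡ = contradiction (≡.trans toward (≡.cong (s ∷_) (≡.trans E≡ (≡.cong (_∷ʳ _) away′)))) E-no-backtrack
  ... | inj₂ E≡ with nonempty a≢b
  ... | t , L , E≡′ with List.∷-injectiveˡ (≡.trans (≡.sym away′) (≡.trans E≡ (≡.cong (_∷ʳ _) E≡′)))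
  ... | ≡.refl = contradiction (≡.trans toward (≡.cong (s ∷_) E≡′)) E-no-backtrack

  toward-refl : ∀ a → a ≢ q → Toward a a
  toward-refl a a≢q with direction a a a≢q
  ... | inj₂ toward = toward
  ... | inj₁ (s , eq , away) with ≡.trans (≡.sym (E-refl a)) away
  ... | ()

  away-parent : ∀ a → a ≢ q → Away a (par a)
  away-parent a a≢q with direction a (par a) a≢q
  ... | inj₁ away = away
  ... | inj₂ (s , eq , toward) with ≡.trans (≡.sym (E-refl (par a))) toward
  ... | ()

  away-q : ∀ a → a ≢ q → Away a q
  away-q a a≢q = edge , joins , E-root
    where open ParentEdge (parentEdge a a≢q)

  -- The end of `s` farther from `q`, that is, the vertex whose parent edge is `s`.
  child : Fin m → Fin n
  child s with E-step q (inj₁ {B = e s ≡ (proj₂ (e s) , proj₁ (e s))} ≡.refl)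
  ... | inj₁ _ = proj₁ (e s)
  ... | inj₂ _ = proj₂ (e s)

  child-parent : ∀ s → EdgeIs e s (child s) (par (child s)) × E (child s) q ≡ s ∷ E (par (child s)) q
  child-parent s with E-step q (inj₁ {B = e s ≡ (proj₂ (e s) , proj₁ (e s))} ≡.refl)
  ... | inj₁ up rewrite parentEdge-unique (inj₁ ≡.refl) up = inj₁ ≡.refl , up
  ... | inj₂ up rewrite parentEdge-unique (inj₂ ≡.refl) up = inj₂ ≡.refl , up

  child≢q : ∀ s → child s ≢ q
  child≢q s c≡q with ≡.trans (≡.sym (E-refl q)) (≡.trans (≡.cong (λ x → E x q) (≡.sym c≡q)) (proj₂ (child-parent s)))
  ... | ()

-- Degrees, and products over vertices and edges

-- The local functions of degree cannot be named: inc is reached through the graph with one edge,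
-- and degree-suc holds because go ignores the graph it is local to.
incidence : ∀ {n} → Fin n × Fin n → Fin n → ℕ
incidence x k = degree {m = 1} (λ _ → x) k

degree-suc : ∀ {n m} (e : Edges n (suc m)) k → degree e k ≡ incidence (e zero) k ℕ.+ degree (e ∘ suc) k
degree-suc e k = ≡.cong (ℕ._+ degree (e ∘ suc) k) (≡.sym (ℕ.+-identityʳ _))

Incident : ∀ {n} → Fin n × Fin n → Fin n → Set
Incident (a , c) k = a ≡ k ⊎ c ≡ k

incidence-1 : ∀ {n} (x : Fin n × Fin n) k → Incident x k → incidence x k ≡ 1
incidence-1 (a , c) k inc with a ≟ k | c ≟ k
... | yes _   | _       = ≡.refl
... | no _    | yes _   = ≡.refl
... | no a≢k  | no c≢k  = contradiction inc [ a≢k , c≢k ]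

module _ {n : ℕ} (k : Fin n) where

  degree-∘suc : ∀ {m} (e : Edges n (suc m)) {x} → x ≤ degree (e ∘ suc) k → x ≤ degree e k
  degree-∘suc e {x} x≤ = ≡.subst (x ≤_) (≡.sym (degree-suc e k)) (ℕ.≤-trans x≤ (ℕ.m≤n+m _ _))

  degree-zero : ∀ {m} (e : Edges n (suc m)) {x} → Incident (e zero) k → x ≤ degree (e ∘ suc) k → suc x ≤ degree e k
  degree-zero e {x} inc x≤ = ≡.subst (suc x ≤_)
    (≡.sym (≡.trans (degree-suc e k) (≡.cong (ℕ._+ degree (e ∘ suc) k) (incidence-1 (e zero) k inc)))) (s≤s x≤)

  degree≥1 : ∀ {m} (e : Edges n m) i → Incident (e i) k → 1 ≤ degree e k
  degree≥1 e zero    inc = degree-zero e inc z≤n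
  degree≥1 e (suc i) inc = degree-∘suc e (degree≥1 (e ∘ suc) i inc)

  degree≥2 : ∀ {m} (e : Edges n m) i j → i ≢ j → Incident (e i) k → Incident (e j) k → 2 ≤ degree e k
  degree≥2 e zero    zero    i≢j _ _       = contradiction ≡.refl i≢j
  degree≥2 e zero    (suc j) _   inc inc′  = degree-zero e inc (degree≥1 (e ∘ suc) j inc′)
  degree≥2 e (suc i) zero    _   inc inc′  = degree-zero e inc′ (degree≥1 (e ∘ suc) i inc)
  degree≥2 e (suc i) (suc j) i≢j inc inc′  = degree-∘suc e (degree≥2 (e ∘ suc) i j (i≢j ∘ ≡.cong suc) inc inc′)

  degree≥3 : ∀ {m} (e : Edges n m) i j l → i ≢ j → i ≢ l → j ≢ l →
             Incident (e i) k → Incident (e j) k → Incident (e l) k → 3 ≤ degree e k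
  degree≥3 e zero zero _ i≢j _ _ _ _ _ = contradiction ≡.refl i≢j
  degree≥3 e zero _ zero _ i≢l _ _ _ _ = contradiction ≡.refl i≢l
  degree≥3 e _ zero zero _ _ j≢l _ _ _ = contradiction ≡.refl j≢l
  degree≥3 e zero (suc j) (suc l) _ _ j≢l x y z = degree-zero e x (degree≥2 (e ∘ suc) j l (j≢l ∘ ≡.cong suc) y z)
  degree≥3 e (suc i) zero (suc l) _ i≢l _ x y z = degree-zero e y (degree≥2 (e ∘ suc) i l (i≢l ∘ ≡.cong suc) x z)
  degree≥3 e (suc i) (suc j) zero i≢j _ _ x y z = degree-zero e z (degree≥2 (e ∘ suc) i j (i≢j ∘ ≡.cong suc) x y)
  degree≥3 e (suc i) (suc j) (suc l) i≢j i≢l j≢l x y z =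
    degree-∘suc e (degree≥3 (e ∘ suc) i j l (i≢j ∘ ≡.cong suc) (i≢l ∘ ≡.cong suc) (j≢l ∘ ≡.cong suc) x y z)

-- Edges correspond to the vertices other than the root

module EdgeReindexing {m : ℕ} (e : Edges (suc m) m) (T : IsTree e) (q : Fin (suc m)) where
  open TreePaths e T
  open Rooted e T q

  parentEdge-child : ∀ s (c≢q : child s ≢ q) → ParentEdge.edge (parentEdge (child s) c≢q) ≡ s
  parentEdge-child s c≢q = List.∷-injectiveˡ (≡.trans (≡.sym (ParentEdge.E-root (parentEdge (child s) c≢q))) (proj₂ (child-parent s)))

  -- Were `child` to pick the other end, the edge would begin both the path from `a` and the path
  -- from `par a` to the root, and the former would backtrack.
  child-parentEdge : ∀ a (a≢q : a ≢ q) → child (ParentEdge.edge (parentEdge a a≢q)) ≡ a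
  child-parentEdge a a≢q with child edge ≟ a
    where open ParentEdge (parentEdge a a≢q)
  ... | yes c≡a = c≡a
  ... | no c≢a  = contradiction (≡.trans E-root (≡.cong (edge ∷_) backtrack)) E-no-backtrack
    where
    open ParentEdge (parentEdge a a≢q)
    other : ∀ {s a b c d} → EdgeIs e s a b → EdgeIs e s c d → c ≢ a → c ≡ b × d ≡ a
    other ab cd c≢a with ab | cd
    ... | inj₁ x | inj₁ y = contradiction (≡.cong proj₁ (≡.trans (≡.sym y) x)) c≢a
    ... | inj₂ x | inj₂ y = contradiction (≡.cong proj₂ (≡.trans (≡.sym y) x)) c≢a
    ... | inj₁ x | inj₂ y = ≡.cong proj₂ (≡.trans (≡.sym y) x) , ≡.cong proj₁ (≡.trans (≡.sym y) x)
    ... | inj₂ x | inj₁ y = ≡.cong proj₁ (≡.trans (≡.sym y) x) , ≡.cong proj₂ (≡.trans (≡.sym y) x)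
    backtrack : E (par a) q ≡ edge ∷ E a q
    backtrack with other joins (proj₁ (child-parent edge)) c≢a | proj₂ (child-parent edge)
    ... | c≡pa , pc≡a | E≡ = ≡.trans (≡.cong (λ x → E x q) (≡.sym c≡pa)) (≡.trans E≡ (≡.cong (λ x → edge ∷ E x q) pc≡a))

  -- The bijection `child`, with the vertices other than `q` renumbered by `punchOut`, so that
  -- invariance of sums under permutations applies.
  edgePermutation : Permutation′ m
  edgePermutation = permutation to from to∘from from∘to
    where
    to : Fin m → Fin m
    to s = punchOut (child≢q s ∘ ≡.sym)
    from : Fin m → Fin m
    from x = ParentEdge.edge (parentEdge (punchIn q x) (punchInᵢ≢i q x))
    to∘from : ∀ x → to (from x) ≡ x
    to∘from x = ≡.trans (punchOut-cong q (child-parentEdge (punchIn q x) (punchInᵢ≢i q x))) (punchOut-punchIn q)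
    from∘to : ∀ s → from (to s) ≡ s
    from∘to s = go (punchIn q (to s)) (punchInᵢ≢i q (to s)) (punchIn-punchOut (child≢q s ∘ ≡.sym))
      where
      go : ∀ a (a≢q : a ≢ q) → a ≡ child s → ParentEdge.edge (parentEdge a a≢q) ≡ s
      go a a≢q ≡.refl = parentEdge-child s a≢q

  module _ {c ℓ : Level} (M : CommutativeMonoid c ℓ) where
    open CommutativeMonoid M
    open Algebra.Properties.CommutativeMonoid.Sum M
    open Relation.Binary.Reasoning.Setoid setoid

    -- Stated for a commutative monoid because it serves twice: multiplicatively for the edge
    -- weights and additively for the degrees.
    sum-child : (g : Fin (suc m) → Carrier) → g q ≈ ε → sum g ≈ sum (g ∘ child)
    sum-child g gq = begin
      sum g                                                        ≈⟨ sum-remove {i = q} g ⟩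
      g q ∙ sum (g ∘ punchIn q)                                    ≈⟨ trans (∙-congʳ gq) (identityˡ _) ⟩
      sum (g ∘ punchIn q)                                          ≈⟨ sum-permute (g ∘ punchIn q) edgePermutation ⟩
      sum (λ s → g (punchIn q (edgePermutation ⟨$⟩ʳ s)))           ≈⟨ sum-cong-≋ (λ s → reflexive (≡.cong g (punchIn-punchOut (child≢q s ∘ ≡.sym)))) ⟩
      sum (g ∘ child)                                              ∎

module _ {c ℓ : Level} (R : CommutativeRing c ℓ) where
  open CommutativeRing R hiding (zero)
  open IntegerSolver R
  open FiniteSums R
  open Relation.Binary.Reasoning.Setoid setoid

  sumList-∷ʳ : ∀ {m} (w : Fin m → Carrier) L s → sumList R w (L ∷ʳ s) ≈ w s + sumList R w L
  sumList-∷ʳ w []      s = refl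
  sumList-∷ʳ w (x ∷ L) s = trans (+-congˡ (sumList-∷ʳ w L s)) (solve 3 (λ x s l → x :+ (s :+ l) := s :+ (x :+ l)) refl _ _ _)

  sumList-reverse : ∀ {m} (w : Fin m → Carrier) L → sumList R w (reverse L) ≈ sumList R w L
  sumList-reverse w []      = refl
  sumList-reverse w (s ∷ L) = begin
    sumList R w (reverse (s ∷ L))     ≡⟨ ≡.cong (sumList R w) (List.unfold-reverse s L) ⟩
    sumList R w (reverse L ∷ʳ s)      ≈⟨ sumList-∷ʳ w (reverse L) s ⟩
    w s + sumList R w (reverse L)     ≈⟨ +-congˡ (sumList-reverse w L) ⟩
    w s + sumList R w L               ∎

  prodFin≡ : ∀ {n} (f : Fin n → Carrier) → prodFin R n f ≡ Algebra.Properties.CommutativeMonoid.Sum.sum *-commutativeMonoid f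
  prodFin≡ {zero}  f = ≡.refl
  prodFin≡ {suc n} f = ≡.cong (f zero *_) (prodFin≡ (f ∘ suc))

  prod-remove : ∀ {n} (i : Fin (suc n)) (f : Fin (suc n) → Carrier) → prodFin R (suc n) f ≈ f i * prodFin R n (f ∘ punchIn i)
  prod-remove i f rewrite prodFin≡ (f ∘ suc) | prodFin≡ (f ∘ punchIn i) =
    Algebra.Properties.CommutativeMonoid.Sum.sum-remove *-commutativeMonoid {i = i} f

  prod-const : ∀ n {f : Fin n → Carrier} {x} → (∀ i → f i ≈ x) → prodFin R n f ≈ pow R x n
  prod-const zero    f≈x = refl
  prod-const (suc n) f≈x = *-cong (f≈x zero) (prod-const n (f≈x ∘ suc))

  prod-const₁ : ∀ n (a : Fin (suc n)) (f : Fin (suc n) → Carrier) {x} → (∀ i → i ≢ a → f i ≈ x) →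
    prodFin R (suc n) f ≈ f a * pow R x n
  prod-const₁ n a f f≈x = trans (prod-remove a f) (*-congˡ (prod-const n (λ i → f≈x (punchIn a i) (punchInᵢ≢i a i))))

  prod-const₂ : ∀ n {a b : Fin (suc (suc n))} (f : Fin (suc (suc n)) → Carrier) {x} → a ≢ b →
    (∀ i → i ≢ a → i ≢ b → f i ≈ x) → prodFin R (suc (suc n)) f ≈ f a * (f b * pow R x n)
  prod-const₂ n {a} {b} f a≢b f≈x = trans (prod-remove a f) (*-congˡ (trans
    (prod-const₁ n (punchOut a≢b) (f ∘ punchIn a) (λ i i≢b → f≈x (punchIn a i) (punchInᵢ≢i a i)
      (λ eq → i≢b (≡.trans (≡.sym (punchOut-punchIn a)) (punchOut-cong a eq)))))
    (*-congʳ (reflexive (≡.cong f (punchIn-punchOut a≢b))))))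

  prod-const₃ : ∀ n {a b c : Fin (suc (suc (suc n)))} (f : Fin (suc (suc (suc n))) → Carrier) {x} → a ≢ b → a ≢ c → b ≢ c →
    (∀ i → i ≢ a → i ≢ b → i ≢ c → f i ≈ x) → prodFin R (suc (suc (suc n))) f ≈ f a * (f b * (f c * pow R x n))
  prod-const₃ n {a} {b} {c} f a≢b a≢c b≢c f≈x = trans (prod-remove a f) (*-congˡ (trans
    (prod-const₂ n (f ∘ punchIn a) (λ eq → b≢c (Fin.punchOut-injective a≢b a≢c eq))
      (λ i i≢b i≢c → f≈x (punchIn a i) (punchInᵢ≢i a i)
        (λ eq → i≢b (≡.trans (≡.sym (punchOut-punchIn a)) (punchOut-cong a eq)))
        (λ eq → i≢c (≡.trans (≡.sym (punchOut-punchIn a)) (punchOut-cong a eq)))))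
    (*-cong (reflexive (≡.cong f (punchIn-punchOut a≢b))) (*-congʳ (reflexive (≡.cong f (punchIn-punchOut a≢c)))))))

  pow-* : ∀ x y k → pow R (x * y) k ≈ pow R x k * pow R y k
  pow-* x y zero    = sym (*-identityˡ 1#)
  pow-* x y (suc k) = trans (*-congˡ (pow-* x y k)) (solve 4 (λ x y a b → x :* y :* (a :* b) := x :* a :* (y :* b)) refl _ _ _ _)

  pow-+ : ∀ x k l → pow R x (k ℕ.+ l) ≈ pow R x k * pow R x l
  pow-+ x zero    l = sym (*-identityˡ _)
  pow-+ x (suc k) l = trans (*-congˡ (pow-+ x k l)) (sym (*-assoc _ _ _))

  -- Recovers, by unification, the factors that prodExcept defines locally.
  factorOf : ∀ {n} {f : Fin n → Carrier} (x : Carrier) → x ≡ prodFin R n f → Fin n → Carrier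
  factorOf {f = f} _ _ = f

  prodExcept≈ : ∀ {n} (q : Fin n) (f : Fin n → Carrier) → prodExcept R n q f ≈ prodFin R n (λ a → at q 1# (f a) a)
  prodExcept≈ {n} q f = prod-cong factor
    where
    factor : ∀ a → factorOf (prodExcept R n q f) ≡.refl a ≈ at q 1# (f a) a
    factor a with a ≟ q
    ... | yes _ = refl
    ... | no _  = refl

  -- A loop would count once on the left and twice on the right, hence the hypothesis on the ends.
  fromℕ-incidence : ∀ {n} (x : Fin n × Fin n) k → proj₁ x ≢ proj₂ x → fromℕ R (incidence x k) ≈ δ (proj₁ x) k + δ (proj₂ x) k
  fromℕ-incidence (a , c) k a≢c = by-ends (a ≟ k) (c ≟ k)
    where
    by-ends : Dec (a ≡ k) → Dec (c ≡ k) → fromℕ R (incidence (a , c) k) ≈ δ a k + δ c k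
    by-ends (yes ≡.refl) (yes ≡.refl) = contradiction ≡.refl a≢c
    by-ends (yes ≡.refl) (no c≢k) = trans (reflexive (≡.cong (fromℕ R) (incidence-1 (a , c) k (inj₁ ≡.refl))))
      (+-cong (sym (δ-same a)) (sym (δ-other (c≢k ∘ ≡.sym))))
    by-ends (no a≢k) (yes ≡.refl) = trans (reflexive (≡.cong (fromℕ R) (incidence-1 (a , c) k (inj₂ ≡.refl))))
      (trans (+-comm 1# 0#) (+-cong (sym (δ-other (a≢k ∘ ≡.sym))) (sym (δ-same c))))
    by-ends (no a≢k) (no c≢k) = trans (reflexive (≡.cong (fromℕ R) incidence-0))
      (trans (sym (+-identityˡ 0#)) (+-cong (sym (δ-other (a≢k ∘ ≡.sym))) (sym (δ-other (c≢k ∘ ≡.sym)))))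
      where
      incidence-0 : incidence (a , c) k ≡ 0
      incidence-0 with a ≟ k | c ≟ k
      ... | yes a≡k | _       = contradiction a≡k a≢k
      ... | no _    | yes c≡k = contradiction c≡k c≢k
      ... | no _    | no _    = ≡.refl

  fromℕ-degree : ∀ {n m} (e : Edges n m) k → fromℕ R (degree e k) ≈ sumFin R m (λ s → fromℕ R (incidence (e s) k))
  fromℕ-degree {m = zero}  e k = refl
  fromℕ-degree {m = suc m} e k = begin
    fromℕ R (degree e k)                                                ≡⟨ ≡.cong (fromℕ R) (degree-suc e k) ⟩
    fromℕ R (incidence (e zero) k ℕ.+ degree (e ∘ suc) k)               ≈⟨ fromℕ-+ (incidence (e zero) k) _ ⟩
    fromℕ R (incidence (e zero) k) + fromℕ R (degree (e ∘ suc) k)       ≈⟨ +-congˡ (fromℕ-degree (e ∘ suc) k) ⟩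
    _                                                                   ∎

-- The tree rooted at a vertex of degree two

module DegreeTwoVertex {c ℓ : Level} (R : CommutativeRing c ℓ) {m : ℕ} (e : Edges (suc m) m) (T : IsTree e)
  (w : Fin m → CommutativeRing.Carrier R) {i j : Fin m} {p q r : Fin (suc m)} (i≢j : i ≢ j)
  (ip : EdgeIs e i p q) (jr : EdgeIs e j q r) (deg-q : degree e q ≡ 2) where
  open CommutativeRing R hiding (zero)
  open IntegerSolver R
  open FiniteSums R
  open TreePaths e T
  open Rooted e T q
  open EdgeReindexing e T q
  open Relation.Binary.Reasoning.Setoid setoid

  jr′ : EdgeIs e j r q
  jr′ = ⊎.swap jr

  -- Among paths to `q` the empty list occurs only at `q` itself; the value `1#` there leaves the
  -- product of the weights unchanged.
  headWeight : List (Fin m) → Carrier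
  headWeight []      = 1#
  headWeight (s ∷ _) = w s

  W : Fin (suc m) → Carrier
  W a = headWeight (E a q)

  -- A decidable form of `Toward`: for `a` other than `q` the two paths differ by exactly the parent
  -- edge of `a`, and the one from `a` is shorter precisely when `b` lies in the subtree of `a`.
  Z : Fin (suc m) → Fin (suc m) → Carrier
  Z a b = if does (length (E a b) ℕ.<? length (E (par a) b)) then 1# else 0#

  Z-toward : ∀ {a b} → Toward a b → Z a b ≈ 1#
  Z-toward {a} {b} (s , _ , E≡) = reflexive (≡.cong (if_then 1# else 0#)
    (dec-true (length (E a b) ℕ.<? length (E (par a) b)) (≡.subst (length (E a b) <_) (≡.sym (≡.cong length E≡)) (ℕ.n<1+n _))))

  Z-away : ∀ {a b} → Away a b → Z a b ≈ 0#
  Z-away {a} {b} (s , _ , E≡) = reflexive (≡.cong (if_then 1# else 0#)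
    (dec-false (length (E a b) ℕ.<? length (E (par a) b)) (λ lt → ℕ.<-asym lt (≡.subst (length (E (par a) b) <_) (≡.sym (≡.cong length E≡)) (ℕ.n<1+n _)))))

  W-edge : ∀ {s a} → a ≢ q → EdgeIs e s a (par a) → W a ≈ w s
  W-edge {s} {a} a≢q eq = reflexive (≡.trans (≡.cong headWeight E-root) (≡.cong w (same-edge joins eq)))
    where open ParentEdge (parentEdge a a≢q)

  child-of-q : ∀ {s a} → EdgeIs e s a q → EdgeIs e s a (par a)
  child-of-q {s} {a} eq = ≡.subst (EdgeIs e s a) (≡.sym (par-child-q eq)) eq

  p≢q : p ≢ q
  p≢q = edge-≢ ip

  r≢q : r ≢ q
  r≢q = edge-≢ jr′

  p≢r : p ≢ r
  p≢r ≡.refl = i≢j (List.∷-injectiveˡ (≡.trans (≡.sym (E-child-q ip)) (E-child-q jr′)))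

  incident : ∀ {s a} → EdgeIs e s a q → Incident (e s) q
  incident (inj₁ eq) = inj₂ (≡.cong proj₂ eq)
  incident (inj₂ eq) = inj₁ (≡.cong proj₁ eq)

  -- The parent edge of a further child would differ from `i` and `j`, and `q` would have degree at
  -- least three.
  children-q : ∀ a → a ≢ q → par a ≡ q → a ≡ p ⊎ a ≡ r
  children-q a a≢q pa≡q with i ≟ edge | j ≟ edge
    where open ParentEdge (parentEdge a a≢q)
  ... | yes ≡.refl | _ = inj₁ (edge-end (⊎.swap (≡.subst (EdgeIs e i a) pa≡q (ParentEdge.joins (parentEdge a a≢q)))) (⊎.swap ip))
  ... | no _ | yes ≡.refl = inj₂ (edge-end (⊎.swap (≡.subst (EdgeIs e j a) pa≡q (ParentEdge.joins (parentEdge a a≢q)))) jr)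
  ... | no i≢ | no j≢ = contradiction
    (degree≥3 q e i j edge i≢j i≢ j≢ (incident ip) (incident jr′) (incident (≡.subst (EdgeIs e edge a) pa≡q joins)))
    (λ 3≤ → ℕ.<-irrefl ≡.refl (≡.subst (3 ≤_) deg-q 3≤))
    where open ParentEdge (parentEdge a a≢q)

  d : Fin (suc m) → Fin (suc m) → Carrier
  d = dist R e T w

  d-refl : ∀ a → d a a ≈ 0#
  d-refl a = reflexive (≡.cong (sumList R w) (E-refl a))

  d-sym : ∀ a b → d a b ≈ d b a
  d-sym a b = sym (trans (reflexive (≡.cong (sumList R w) (E-reverse a b))) (sumList-reverse R w (E a b)))

  d-par : ∀ a b → a ≢ q → d a b ≈ d (par a) b + W a * (1# - fromℕ R 2 * Z a b)
  d-par a b a≢q with direction a b a≢q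
  ... | inj₁ away@(s , eq , E≡) = begin
    d a b                                               ≡⟨ ≡.cong (sumList R w) E≡ ⟩
    w s + d (par a) b                                   ≈⟨ solve 2 (λ x y → x :+ y := y :+ x :* (:1 :- :2 :* :0)) refl _ _ ⟩
    d (par a) b + w s * (1# - fromℕ R 2 * 0#)           ≈⟨ +-congˡ (*-cong (W-edge a≢q eq) (+-congˡ (-‿cong (*-congˡ (Z-away away))))) ⟨
    d (par a) b + W a * (1# - fromℕ R 2 * Z a b)        ∎
  ... | inj₂ toward@(s , eq , E≡) = begin
    d a b                                               ≈⟨ solve 2 (λ x y → y := x :+ y :+ x :* (:1 :- :2 :* :1)) refl _ _ ⟩
    w s + d a b + w s * (1# - fromℕ R 2 * 1#)           ≈⟨ +-cong (reflexive (≡.cong (sumList R w) E≡)) (*-cong (W-edge a≢q eq) (+-congˡ (-‿cong (*-congˡ (Z-toward toward))))) ⟨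
    d (par a) b + W a * (1# - fromℕ R 2 * Z a b)        ∎

  Z-par : ∀ a b → a ≢ q → b ≢ q → Z a b ≈ Z a (par b) + δ a b
  Z-par a b a≢q b≢q = by-≡ (a ≟ b)
    where
    by-≡ : Dec (a ≡ b) → Z a b ≈ Z a (par b) + δ a b
    by-≡ (yes ≡.refl) = trans (Z-toward (toward-refl a a≢q))
      (sym (trans (+-cong (Z-away (away-parent a a≢q)) (δ-same a)) (+-identityˡ 1#)))
    by-≡ (no a≢b) = sym (trans (+-congˡ (δ-other (a≢b ∘ ≡.sym))) (trans (+-identityʳ _) same))
      where
      same : Z a (par b) ≈ Z a b
      same with direction a b a≢q
      ... | inj₁ away   = trans (Z-away (away-par a b a≢q b≢q a≢b away)) (sym (Z-away away))
      ... | inj₂ toward = trans (Z-toward (toward-par a b a≢q b≢q a≢b toward)) (sym (Z-toward toward))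

  rootedTree : RootedTree R (suc m)
  rootedTree = record
    { q = q ; p = p ; r = r ; p≢q = p≢q ; r≢q = r≢q ; p≢r = p≢r ; par = par ; height = height
    ; par-q = par-q ; par-p = par-child-q ip ; par-r = par-child-q jr′ ; par-< = par-<
    ; height-pr = ≡.trans (≡.cong length (E-child-q ip)) (≡.sym (≡.cong length (E-child-q jr′)))
    ; children-q = children-q ; W = W ; d = d ; Z = Z ; W-q = reflexive (≡.cong headWeight (E-refl q))
    ; d-refl = d-refl ; d-sym = d-sym ; d-par = d-par
    ; Z-root = λ a a≢q → Z-away (away-q a a≢q) ; Z-par = Z-par }

  open RootedTreeDeterminant R rootedTree using (t; ch; rowFactor; y; s; det-squaredDistances; onCore)

  child-edge : ∀ s → EdgeIs e s (child s) (par (child s))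
  child-edge s = proj₁ (child-parent s)

  prod-W : prodFin R m w ≈ prodFin R (suc m) W
  prod-W = sym (begin
    prodFin R (suc m) W             ≡⟨ prodFin≡ R W ⟩
    _                               ≈⟨ sum-child *-commutativeMonoid W (reflexive (≡.cong headWeight (E-refl q))) ⟩
    _                               ≡⟨ prodFin≡ R (W ∘ child) ⟨
    prodFin R m (W ∘ child)         ≈⟨ prod-cong (λ s → W-edge (child≢q s) (child-edge s)) ⟩
    prodFin R m w                   ∎)

  -- Each edge `s` meets `child s` and the parent of `child s`. Summed over vertices in place of
  -- edges, the first kind of incidence occurs at `a` once, through its own parent edge, and the
  -- second once for each child of `a`.
  fromℕ-degree-child : ∀ a → a ≢ q → fromℕ R (degree e a) ≈ 1# + ch a
  fromℕ-degree-child a a≢q = begin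
    fromℕ R (degree e a)                                            ≈⟨ fromℕ-degree R e a ⟩
    sumFin R m (λ s → fromℕ R (incidence (e s) a))                  ≈⟨ sum-cong edge-ends ⟩
    sumFin R m (g ∘ child)                                          ≡⟨ sumFin≡sum (g ∘ child) ⟩
    _                                                               ≈⟨ sum-child +-commutativeMonoid g g-q ⟨
    _                                                               ≡⟨ sumFin≡sum g ⟨
    sumFin R (suc m) g                                              ≈⟨ sum-+ (λ x → δ x a) (λ x → δ (par x) a) ⟩
    sumFin R (suc m) (λ x → δ x a) + ch a                           ≈⟨ +-congʳ (trans (sum-single a (λ x → δ x a) (λ x x≢a → δ-other (x≢a ∘ ≡.sym))) (δ-same a)) ⟩
    1# + ch a                                                       ∎
    where
    g : Fin (suc m) → Carrier
    g x = δ x a + δ (par x) a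
    g-q : g q ≈ 0#
    g-q = trans (+-cong (δ-other a≢q) (δ-other (λ a≡pq → a≢q (≡.trans a≡pq par-q)))) (+-identityˡ 0#)
    edge-ends : ∀ s → fromℕ R (incidence (e s) a) ≈ g (child s)
    edge-ends s with child-edge s
    ... | inj₁ eq = trans (fromℕ-incidence R (e s) a (IsTree.loopless T s))
      (+-cong (reflexive (≡.cong (λ x → δ (proj₁ x) a) eq)) (reflexive (≡.cong (λ x → δ (proj₂ x) a) eq)))
    ... | inj₂ eq = trans (fromℕ-incidence R (e s) a (IsTree.loopless T s))
      (trans (+-comm _ _) (+-cong (reflexive (≡.cong (λ x → δ (proj₂ x) a) eq)) (reflexive (≡.cong (λ x → δ (proj₁ x) a) eq))))

  t≈τ : ∀ a → a ≢ q → t a ≈ τ R e a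
  t≈τ a a≢q = sym (trans (+-congˡ (-‿cong (fromℕ-degree-child a a≢q)))
    (solve 1 (λ k → :2 :- (:1 :+ k) := :1 :- k) refl _))

  2# : Carrier
  2# = fromℕ R 2

  -- The constants of `rowFactor` and `y` collected vertex by vertex: -2 from the row and 2 from the
  -- diagonal, the latter missing at `p`.
  coefficient : Fin (suc m) → Carrier
  coefficient a = onCore 1# (at p (- 2#) (- (2# * 2#)) a) a

  prod-coefficients : prodFin R (suc m) rowFactor * (t r * prodFin R (suc m) y)
                    ≈ prodFin R (suc m) coefficient * prodExcept R (suc m) q (τ R e)
  prod-coefficients = begin
    prodFin R (suc m) rowFactor * (t r * prodFin R (suc m) y)
      ≈⟨ *-congˡ (*-congʳ prod-ζ) ⟨
    prodFin R (suc m) rowFactor * (prodFin R (suc m) ζ * prodFin R (suc m) y)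
      ≈⟨ *-congˡ (prod-* ζ y) ⟨
    prodFin R (suc m) rowFactor * prodFin R (suc m) (λ a → ζ a * y a)
      ≈⟨ prod-* rowFactor (λ a → ζ a * y a) ⟨
    prodFin R (suc m) (λ a → rowFactor a * (ζ a * y a))
      ≈⟨ prod-cong factor ⟩
    prodFin R (suc m) (λ a → coefficient a * at q 1# (τ R e a) a)
      ≈⟨ prod-* coefficient (λ a → at q 1# (τ R e a) a) ⟩
    prodFin R (suc m) coefficient * prodFin R (suc m) (λ a → at q 1# (τ R e a) a)
      ≈⟨ *-congˡ (prodExcept≈ R q (τ R e)) ⟨
    prodFin R (suc m) coefficient * prodExcept R (suc m) q (τ R e) ∎
    where
    -- Spreads the scalar `t r` over a product, so that it supplies the factor at `r` that
    -- `rowFactor` lacks.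
    ζ : Fin (suc m) → Carrier
    ζ = at r (t r) 1#
    prod-ζ : prodFin R (suc m) ζ ≈ t r
    prod-ζ = trans (prod-const₁ R m r ζ (λ a a≢r → reflexive (at-other a≢r)))
      (trans (*-cong (reflexive (at-same r)) (pow-1 m)) (*-identityʳ _))
      where
      pow-1 : ∀ k → pow R 1# k ≈ 1#
      pow-1 zero    = refl
      pow-1 (suc k) = trans (*-identityˡ _) (pow-1 k)
    factor : ∀ a → rowFactor a * (ζ a * y a) ≈ coefficient a * at q 1# (τ R e a) a
    factor a with a ≟ q | a ≟ r | a ≟ p
    ... | yes ≡.refl | yes q≡r    | _          = contradiction (≡.sym q≡r) r≢q
    ... | yes ≡.refl | no _       | _          = solve 0 (:1 :* (:1 :* :1) := :1 :* :1) refl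
    ... | no _       | yes ≡.refl | _          = trans (solve 1 (λ k → :1 :* (k :* :1) := :1 :* k) refl _) (*-congˡ (t≈τ r r≢q))
    ... | no _       | no _       | yes ≡.refl = trans (solve 1 (λ k → :- (:2 :* k) :* (:1 :* :1) := :- :2 :* k) refl _) (*-congˡ (t≈τ p p≢q))
    ... | no a≢q     | no _       | no _       = trans (solve 1 (λ k → :- (:2 :* k) :* (:1 :* :2) := :- (:2 :* :2) :* k) refl _) (*-congˡ (t≈τ a a≢q))

  s≈ : s ≈ w i + w j
  s≈ = +-cong (W-edge p≢q (child-of-q ip)) (W-edge r≢q (child-of-q jr′))

  prod-coefficient : ∀ k → m ≡ suc (suc k) → prodFin R (suc m) coefficient ≈ - 2# * pow R (- (2# * 2#)) k
  prod-coefficient k ≡.refl = trans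
    (prod-const₃ R k coefficient (r≢q ∘ ≡.sym) (p≢q ∘ ≡.sym) (p≢r ∘ ≡.sym)
      (λ a a≢q a≢r a≢p → reflexive (≡.trans (at-other a≢q) (≡.trans (at-other a≢r) (at-other a≢p)))))
    (trans (*-cong (reflexive (at-same q)) (*-cong (reflexive (≡.trans (at-other r≢q) (at-same r)))
        (*-congʳ (reflexive (≡.trans (at-other p≢q) (≡.trans (at-other p≢r) (at-same p)))))))
      (solve 1 (λ x → :1 :* (:1 :* (:- :2 :* x)) := :- :2 :* x) refl _))

  -- `k` counts the vertices other than `q`, `r` and `p`, so there are `k + 3` vertices and the
  -- exponent of 2 is `2k + 1`. The minus sign on the right cancels the one from the exchange of
  -- rows.
  power-of-2 : ∀ k → - 2# * pow R (- (2# * 2#)) k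
                   ≈ - (pow R (- 1#) (suc (suc k)) * pow R 2# (2 ℕ.* suc (suc (suc k)) ∸ 5))
  power-of-2 k = begin
    - 2# * pow R (- (2# * 2#)) k
      ≈⟨ *-congˡ (trans (pow-cong (solve 0 (:- (:2 :* :2) := :- :1 :* (:2 :* :2)) refl) k)
           (trans (pow-* R (- 1#) (2# * 2#) k) (*-congˡ (trans (pow-* R 2# 2# k) (sym (pow-+ R 2# k k)))))) ⟩
    - 2# * (pow R (- 1#) k * pow R 2# (k ℕ.+ k))
      ≈⟨ solve 2 (λ x y → :- :2 :* (x :* y) := :- (:- :1 :* (:- :1 :* x) :* (:2 :* y))) refl _ _ ⟩
    - (pow R (- 1#) (suc (suc k)) * pow R 2# (suc (k ℕ.+ k)))
      ≡⟨ ≡.cong (λ l → - (pow R (- 1#) (suc (suc k)) * pow R 2# l)) exponent ⟨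
    - (pow R (- 1#) (suc (suc k)) * pow R 2# (2 ℕ.* suc (suc (suc k)) ∸ 5)) ∎
    where
    pow-cong : ∀ {x y} → x ≈ y → ∀ k → pow R x k ≈ pow R y k
    pow-cong x≈y zero    = refl
    pow-cong x≈y (suc k) = *-cong x≈y (pow-cong x≈y k)
    exponent : 2 ℕ.* suc (suc (suc k)) ∸ 5 ≡ suc (k ℕ.+ k)
    exponent = ≡.cong (_∸ 5) (double k)
      where
      double : ∀ k → 2 ℕ.* suc (suc (suc k)) ≡ 5 ℕ.+ suc (k ℕ.+ k)
      double = ℕ-Solver.solve-∀

  -- Two distinct edges force at least three vertices, so the subtraction of 5 in the exponent is
  -- not truncated.
  m≥2 : ∃ λ k → m ≡ suc (suc k)
  m≥2 = two-elements i j i≢j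
    where
    two-elements : ∀ {m} (i j : Fin m) → i ≢ j → ∃ λ k → m ≡ suc (suc k)
    two-elements {suc zero}    zero zero i≢j = contradiction ≡.refl i≢j
    two-elements {suc (suc k)} _    _    _   = k , ≡.refl

  det-Δ : det R (suc m) (Δ R e T w)
    ≈ pow R (- 1#) (suc m ∸ 1) * pow R 2# (2 ℕ.* suc m ∸ 5)
      * ((w i + w j) * (w i + w j)) * prodFin R m (λ s → w s * w s) * prodExcept R (suc m) q (τ R e)
  det-Δ = begin
    det R (suc m) (Δ R e T w)
      ≈⟨ det-squaredDistances ⟩
    P * (P * (s * (s * - (prodFin R (suc m) rowFactor * (t r * prodFin R (suc m) y)))))
      ≈⟨ *-congˡ (*-congˡ (*-cong s≈ (*-cong s≈ (-‿cong (trans prod-coefficients (*-congʳ (sign (proj₁ m≥2) (proj₂ m≥2)))))))) ⟩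
    P * (P * (σ * (σ * - (- (g * h) * u))))
      ≈⟨ solve 5 (λ P σ g h u → P :* (P :* (σ :* (σ :* (:- (:- (g :* h) :* u))))) := g :* h :* (σ :* σ) :* (P :* P) :* u) refl P σ g h u ⟩
    g * h * (σ * σ) * (P * P) * u
      ≈⟨ *-congʳ (*-congˡ (trans (prod-* w w) (*-cong prod-W prod-W))) ⟨
    g * h * (σ * σ) * prodFin R m (λ s → w s * w s) * u ∎
    where
    P = prodFin R (suc m) W
    σ = w i + w j
    g = pow R (- 1#) (suc m ∸ 1)
    h = pow R 2# (2 ℕ.* suc m ∸ 5)
    u = prodExcept R (suc m) q (τ R e)
    sign : ∀ k → m ≡ suc (suc k) → prodFin R (suc m) coefficient ≈ - (g * h)
    sign k m≡ = trans (prod-coefficient k m≡) (trans (power-of-2 k)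
      (reflexive (≡.cong (λ m → - (pow R (- 1#) (suc m ∸ 1) * pow R 2# (2 ℕ.* suc m ∸ 5))) (≡.sym m≡))))

theorem3p3 : ∀ {c ℓ : Level} (R : CommutativeRing c ℓ) →
    let open CommutativeRing R hiding (zero) in
    (m : ℕ) (e : Edges (suc m) m) (T : IsTree e)
    (w : Fin m → Carrier) → (∀ s → ¬ (w s ≈ 0#)) →
    (i j : Fin m) (p q r : Fin (suc m)) →
    i ≢ j → EdgeIs e i p q → EdgeIs e j q r → degree e q ≡ 2 →
    det R (suc m) (Δ R e T w)
      ≈ pow R (- 1#) (suc m ∸ 1) * pow R (fromℕ R 2) (Data.Nat._*_ 2 (suc m) ∸ 5)
        * ((w i + w j) * (w i + w j))
        * prodFin R m (λ s → w s * w s)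
        * prodExcept R (suc m) q (τ R e)
theorem3p3 R m e T w _ i j p q r i≢j ip jr deg-q = DegreeTwoVertex.det-Δ R e T w i≢j ip jr deg-q
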